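{- Let $G$ be a connected digraph, $k \ge 3$ an integer and $X \subseteq V(G)$ such that: (i) $d(u) \le 2(k-1)$ for every $u \in X$; (ii) for every connected component $S$ of $G[X]$, $\vec{\chi}(G-S) \le k-1$; (iii) the number of connected components of $G-X$ is strictly greater than the number of connected components of $G[X]$. Then $\vec{\chi}(G) \le k-1$.
   Context: Digraphs are finite, without loops and parallel arcs (digons allowed). $d(u)=d^+(u)+d^-(u)$. A dicolouring colours vertices so that each colour class induces an acyclic subdigraph; $\vec{\chi}$ is the minimum number of colours. Connectivity is weak connectivity; a connected component is a maximal vertex set inducing a connected subdigraph. Convention: the empty set is considered connected, so the empty digraph has exactly one connected component (the empty set). -}

module Defs where

open import Data.Nat using (ℕ; _+_)
open import Data.Bool using (Bool; true; false)
open import Data.Fin using (Fin)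
open import Data.Fin.Subset using (Subset; _∈_; _⊆_; ∁; _∩_; ∣_∣)
open import Data.Vec using (tabulate)
open import Data.List using (List; length)
open import Data.List.Relation.Unary.All using (All)
open import Data.List.Relation.Unary.Unique.Propositional using (Unique)
import Data.List.Membership.Propositional as LM
open import Data.Product using (Σ; _×_; ∃)
open import Data.Sum using (_⊎_)
open import Data.Empty using (⊥)
open import Relation.Nullary using (¬_)
open import Relation.Nullary.Decidable using (⌊_⌋)
open import Relation.Binary.PropositionalEquality using (_≡_)
open import Relation.Binary.Construct.Closure.ReflexiveTransitive using (Star)
import Data.Fin as F

-- A finite digraph on vertex set Fin n: arcs given by a Boolean adjacency
-- relation; no loops; no parallel arcs (automatic); digons allowed.
record Digraph : Set where
  field
    n        : ℕ
    arc      : Fin n → Fin n → Bool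
    loopless : ∀ u → arc u u ≡ false

module _ (G : Digraph) where
  open Digraph G

  Arc : Fin n → Fin n → Set
  Arc u v = arc u v ≡ true

  outdeg : Fin n → ℕ
  outdeg u = ∣ tabulate (λ v → arc u v) ∣

  indeg : Fin n → ℕ
  indeg u = ∣ tabulate (λ v → arc v u) ∣

  deg : Fin n → ℕ
  deg u = outdeg u + indeg u

  data Walk (T : Subset n) : Fin n → Fin n → Set where
    step : ∀ {u v} → u ∈ T → v ∈ T → Arc u v → Walk T u v
    _∷_  : ∀ {u w v} → (u ∈ T × Arc u w) → Walk T w v → Walk T u v

  Acyclic : Subset n → Set
  Acyclic T = ∀ u → ¬ Walk T u u

  DichromaticLE : Subset n → ℕ → Set
  DichromaticLE T m =
    Σ (Fin n → Fin m) λ c →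
      ∀ (i : Fin m) → Acyclic (T ∩ tabulate (λ v → ⌊ c v F.≟ i ⌋))

  UAdj : Subset n → Fin n → Fin n → Set
  UAdj T u v = u ∈ T × v ∈ T × (Arc u v ⊎ Arc v u)

  -- G[T] is (weakly) connected; the empty set is connected
  Connected : Subset n → Set
  Connected T = ∀ u v → u ∈ T → v ∈ T → Star (UAdj T) u v

  -- S is a connected component of G[X]: a maximal connected subset of X
  -- (with the empty-set convention, G[∅] has exactly one component, ∅)
  Component : Subset n → Subset n → Set
  Component X S =
    S ⊆ X × Connected S ×
    (∀ S' → S ⊆ S' → S' ⊆ X → Connected S' → S' ⊆ S)

  -- L is a duplicate-free list of exactly the connected components of G[X];
  -- its length is the number of connected components of G[X]
  ComponentList : Subset n → List (Subset n) → Set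
  ComponentList X L =
    Unique L × All (Component X) L × (∀ S → Component X S → S LM.∈ L)

  ConnectedDigraph : Set
  ConnectedDigraph = Connected (tabulate (λ _ → true))

  DichromaticGLE : ℕ → Set
  DichromaticGLE m = DichromaticLE (tabulate (λ _ → true)) m

{-# OPTIONS --safe #-}
-- Contract each component of G - X to a block; the components of G[X] are the parts, N(W) is
-- the set of blocks touched by the parts in W, and m = k - 1. For a largest W with
-- |N(W)| ≤ |W| some part S₀ is outside W, and a colouring of G - S₀ settles W and N(W), which
-- are glued into one block. Every nonempty set U of parts outside W then satisfies
-- |N(U)| > |U|, which is Lovász's strict form of Hall's condition.
--
-- A block may be recoloured by any permutation of the colours. Pick a suitable part, peel off vertices
-- with a neighbour left in the part as long as they see one block only, colouring them
-- greedily into that block, until a vertex v sees vertices x and y of two blocks. Permute the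
-- colours of one of these blocks so that x and y agree, glue the two blocks, and colour the
-- other parts by induction; the rest of the part is then coloured greedily towards v. Since
-- deg v ≤ 2m and x, y share a colour, either v has a colour absent from its in- or from its
-- out-neighbours, or x and y lie on different sides of v and are its only neighbours of their
-- colour. In the latter case v takes that colour: this creates only paths from one glued
-- block to the other in a single direction, hence no cycle. Such directions are recorded by
-- a height function, constant on blocks and increasing along the other monochromatic arcs.

module Submission where

open import Defs
open import Data.Bool using (true; false; if_then_else_)
import Data.Bool as Bool
open import Data.Fin using (Fin; zero; suc; _≟_)
open import Data.Fin.Permutation.Components using (transpose; transpose-inverse)
open import Data.Fin.Properties using (any?; toℕ<n; suc-injective; 0≢1+n)
open import Data.Fin.Subset
  using (Subset; _∈_; _∉_; _⊆_; ∁; _∩_; _∪_; _─_; _-_; ∣_∣; Nonempty; Empty; ⁅_⁆; ⊤; ⊥)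
open import Data.Fin.Subset.Properties
open import Data.List using (List; []; _∷_; _∷ʳ_; length; lookup)
import Data.List.Membership.DecPropositional
import Data.List.Membership.Propositional as List
open import Data.List.Membership.Propositional.Properties using (∈-lookup)
open import Data.List.Relation.Binary.Permutation.Propositional
  using (_↭_; ↭-refl; ↭-sym; ↭-trans; prep; ↭⇒↭ₛ)
open import Data.List.Relation.Binary.Permutation.Propositional.Properties using (∈-resp-↭; ∷↭∷ʳ)
import Data.List.Relation.Binary.Permutation.Setoid.Properties
open import Data.List.Relation.Unary.All using (All; []; _∷_)
import Data.List.Relation.Unary.All as All
open import Data.List.Relation.Unary.AllPairs using ([]; _∷_)
open import Data.List.Relation.Unary.Any using (here; there; index)
open import Data.List.Relation.Unary.Any.Properties using (lookup-index; ++⁺ˡ; ++⁺ʳ; ++⁻)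
open import Data.List.Relation.Unary.Unique.Propositional using (Unique)
open import Data.Nat
  using (ℕ; zero; suc; _≤_; _<_; _+_; _*_; _∸_; _⊔_; z≤n; s≤s; s≤s⁻¹; z<s; _≤?_; _<?_)
open import Data.Nat.Properties hiding (_≟_; 0≢1+n; suc-injective; _≤?_; _<?_)
open import Data.Product using (Σ; ∃; _×_; _,_; proj₁; proj₂)
open import Data.Sum using (_⊎_; inj₁; inj₂; [_,_]′)
import Data.Sum as Sum
open import Data.Sum.Properties using (inj₁-injective; inj₂-injective; ≡-dec)
open import Data.Vec using (tabulate; []; _∷_; here; there)
open import Data.Vec.Functional using (updateAt)
open import Data.Vec.Functional.Properties using (updateAt-updates; updateAt-minimal)
open import Data.Vec.Properties using (lookup⇒[]=; []=⇒lookup; lookup∘tabulate)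
open import Function using (_∘_; const; case_of_; Injective)
open import Relation.Binary.Construct.Closure.ReflexiveTransitive using (Star; ε; _◅_; _◅◅_)
import Relation.Binary.Construct.Closure.ReflexiveTransitive as Star
open import Relation.Binary.PropositionalEquality
open import Relation.Nullary using (¬_; Dec; yes; no; does; contradiction)
open import Relation.Nullary.Decidable
  using (⌊_⌋; _×-dec_; _⊎-dec_; ¬?; dec-true; dec-false; decidable-stable; isYes≗does; map′)
open import Relation.Unary using (Decidable)

-- Finite sets and Hall's condition

abstract
  ⟪_⟫ : ∀ {n} {P : Fin n → Set} → Decidable P → Subset n
  ⟪ P? ⟫ = tabulate (λ x → does (P? x))

  ∈⟪⟫⁺ : ∀ {n} {P : Fin n → Set} (P? : Decidable P) {x} → P x → x ∈ ⟪ P? ⟫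
  ∈⟪⟫⁺ P? {x} Px = lookup⇒[]= x _ (trans (lookup∘tabulate _ x) (dec-true (P? x) Px))

  ∈⟪⟫⁻ : ∀ {n} {P : Fin n → Set} (P? : Decidable P) {x} → x ∈ ⟪ P? ⟫ → P x
  ∈⟪⟫⁻ P? {x} x∈ with P? x | trans (sym (lookup∘tabulate (λ y → does (P? y)) x)) ([]=⇒lookup x∈)
  ... | yes Px | _ = Px
  ... | no _   | ()

∣p∪q∣+∣p∩q∣≡∣p∣+∣q∣ : ∀ {n} (p q : Subset n) → ∣ p ∪ q ∣ + ∣ p ∩ q ∣ ≡ ∣ p ∣ + ∣ q ∣
∣p∪q∣+∣p∩q∣≡∣p∣+∣q∣ []          []          = refl
∣p∪q∣+∣p∩q∣≡∣p∣+∣q∣ (true ∷ p)  (true ∷ q)  = cong suc (begin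
  ∣ p ∪ q ∣ + suc ∣ p ∩ q ∣  ≡⟨ +-suc _ _ ⟩
  suc (∣ p ∪ q ∣ + ∣ p ∩ q ∣) ≡⟨ cong suc (∣p∪q∣+∣p∩q∣≡∣p∣+∣q∣ p q) ⟩
  suc (∣ p ∣ + ∣ q ∣)        ≡⟨ +-suc _ _ ⟨
  ∣ p ∣ + suc ∣ q ∣          ∎)
  where open ≡-Reasoning
∣p∪q∣+∣p∩q∣≡∣p∣+∣q∣ (true ∷ p)  (false ∷ q) = cong suc (∣p∪q∣+∣p∩q∣≡∣p∣+∣q∣ p q)
∣p∪q∣+∣p∩q∣≡∣p∣+∣q∣ (false ∷ p) (true ∷ q)  =
  trans (cong suc (∣p∪q∣+∣p∩q∣≡∣p∣+∣q∣ p q)) (sym (+-suc _ _))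
∣p∪q∣+∣p∩q∣≡∣p∣+∣q∣ (false ∷ p) (false ∷ q) = ∣p∪q∣+∣p∩q∣≡∣p∣+∣q∣ p q

∣p∪q∣≤∣p∣+∣q∣ : ∀ {n} (p q : Subset n) → ∣ p ∪ q ∣ ≤ ∣ p ∣ + ∣ q ∣
∣p∪q∣≤∣p∣+∣q∣ p q = ≤-trans (m≤m+n _ _) (≤-reflexive (∣p∪q∣+∣p∩q∣≡∣p∣+∣q∣ p q))

empty⇒∣p∣≡0 : ∀ {n} {p : Subset n} → Empty p → ∣ p ∣ ≡ 0
empty⇒∣p∣≡0 {n} e = trans (cong ∣_∣ (Empty-unique e)) (∣⊥∣≡0 n)

0<∣p∣⇒nonempty : ∀ {n} {p : Subset n} → 0 < ∣ p ∣ → Nonempty p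
0<∣p∣⇒nonempty {p = p} 0<p with nonempty? p
... | yes ne = ne
... | no  e  = contradiction (empty⇒∣p∣≡0 e) (≢-sym (<⇒≢ 0<p))

x∈p─q⇒x∉q : ∀ {n} {x : Fin n} (p q : Subset n) → x ∈ p ─ q → x ∉ q
x∈p─q⇒x∉q (true ∷ p) (false ∷ q) here       ()
x∈p─q⇒x∉q (_ ∷ p)    (true ∷ q)  (there x∈) (there x∈q) = x∈p─q⇒x∉q p q x∈ x∈q
x∈p─q⇒x∉q (_ ∷ p)    (false ∷ q) (there x∈) (there x∈q) = x∈p─q⇒x∉q p q x∈ x∈q

x∉p-x : ∀ {n} (x : Fin n) (p : Subset n) → x ∉ p - x
x∉p-x x p x∈ = x∈p─q⇒x∉q p ⁅ x ⁆ x∈ (x∈⁅x⁆ x)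

∈-⇒≢ : ∀ {n} {x y : Fin n} {p : Subset n} → x ∈ p - y → x ≢ y
∈-⇒≢ {p = p} x∈ refl = x∉p-x _ p x∈

∣p∣≤1+∣p-x∣ : ∀ {n} (p : Subset n) (x : Fin n) → ∣ p ∣ ≤ suc ∣ p - x ∣
∣p∣≤1+∣p-x∣ p x = begin
  ∣ p ∣                 ≤⟨ p⊆q⇒∣p∣≤∣q∣ cover ⟩
  ∣ ⁅ x ⁆ ∪ (p - x) ∣   ≤⟨ ∣p∪q∣≤∣p∣+∣q∣ ⁅ x ⁆ (p - x) ⟩
  ∣ ⁅ x ⁆ ∣ + ∣ p - x ∣ ≡⟨ cong (_+ ∣ p - x ∣) (∣⁅x⁆∣≡1 x) ⟩
  suc ∣ p - x ∣         ∎
  where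
  open ≤-Reasoning
  cover : p ⊆ ⁅ x ⁆ ∪ (p - x)
  cover {y} y∈p with y ≟ x
  ... | yes refl = x∈p∪q⁺ (inj₁ (x∈⁅x⁆ x))
  ... | no  y≢x  = x∈p∪q⁺ (inj₂ (x∈p∧x≢y⇒x∈p-y y∈p y≢x))

distinct⇒2≤∣p∣ : ∀ {n} {p : Subset n} {x y} → x ∈ p → y ∈ p → x ≢ y → 2 ≤ ∣ p ∣
distinct⇒2≤∣p∣ x∈p y∈p x≢y =
  ≤-<-trans (≤-<-trans z≤n (x∈p⇒∣p-x∣<∣p∣ (x∈p∧x≢y⇒x∈p-y y∈p (x≢y ∘ sym)))) (x∈p⇒∣p-x∣<∣p∣ x∈p)

2≤∣p∣⇒distinct : ∀ {n} {p : Subset n} → 2 ≤ ∣ p ∣ → ∃ λ x → ∃ λ y → x ∈ p × y ∈ p × x ≢ y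
2≤∣p∣⇒distinct {p = p} 2≤p with 0<∣p∣⇒nonempty (<-trans z<s 2≤p)
... | x , x∈p with 0<∣p∣⇒nonempty {p = p - x} (s≤s⁻¹ (≤-trans 2≤p (∣p∣≤1+∣p-x∣ p x)))
... | y , y∈ = x , y , x∈p , p─q⊆p p ⁅ x ⁆ y∈ , λ x≡y → ∈-⇒≢ {p = p} y∈ (sym x≡y)

injection⇒≤∣p∣ : ∀ {n} k (f : Fin k → Fin n) → Injective _≡_ _≡_ f →
                 {p : Subset n} → (∀ i → f i ∈ p) → k ≤ ∣ p ∣
injection⇒≤∣p∣ zero    f inj f∈ = z≤n
injection⇒≤∣p∣ (suc k) f inj f∈ = ≤-<-trans
  (injection⇒≤∣p∣ k (f ∘ suc) (suc-injective ∘ inj)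
    (λ i → x∈p∧x≢y⇒x∈p-y (f∈ (suc i)) (λ e → 0≢1+n (sym (inj e)))))
  (x∈p⇒∣p-x∣<∣p∣ (f∈ zero))

-- Descent: as long as some subset with `P` has a smaller value, move to it. The fuel `k` bounds the
-- current value.
minimal-subset : ∀ {n} {P : Subset n → Set} → Decidable P → (f : Subset n → ℕ) → ∃ P →
                 ∃ λ A → P A × (∀ B → P B → f A ≤ f B)
minimal-subset {P = P} P? f (A₀ , PA₀) = descend (f A₀) A₀ PA₀ ≤-refl
  where
  descend : ∀ k A → P A → f A ≤ k → ∃ λ A → P A × (∀ B → P B → f A ≤ f B)
  descend k A PA fA≤k with anySubset? (λ B → P? B ×-dec (f B <? f A))
  ... | no ¬smaller = A , PA , λ B PB → ≮⇒≥ (λ fB<fA → ¬smaller (B , PB , fB<fA))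
  descend zero    A PA fA≤k | yes (B , PB , fB<fA) = contradiction (<-≤-trans fB<fA fA≤k) λ ()
  descend (suc k) A PA fA≤k | yes (B , PB , fB<fA) = descend k B PB (s≤s⁻¹ (<-≤-trans fB<fA fA≤k))

image : ∀ {n m} → (Fin n → Fin m) → Subset n → Subset m
image ρ A = ⟪ (λ b → any? λ a → (a ∈? A) ×-dec (ρ a ≟ b)) ⟫

∈-image⁺ : ∀ {n m} (ρ : Fin n → Fin m) {A a} → a ∈ A → ρ a ∈ image ρ A
∈-image⁺ ρ {A} {a} a∈A = ∈⟪⟫⁺ (λ b → any? λ a → (a ∈? A) ×-dec (ρ a ≟ b)) (a , a∈A , refl)

∈-image⁻ : ∀ {n m} (ρ : Fin n → Fin m) {A b} → b ∈ image ρ A → ∃ λ a → a ∈ A × ρ a ≡ b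
∈-image⁻ ρ {A} = ∈⟪⟫⁻ (λ b → any? λ a → (a ∈? A) ×-dec (ρ a ≟ b))

-- Gluing as a renaming of `E` to `D`. The index type of the labels stays the same; for `D ≢ E` the
-- label `E` simply becomes vacant.
identify : ∀ {n} → Fin n → Fin n → Fin n → Fin n
identify D E b = if does (b ≟ E) then D else b

identify-at : ∀ {n} (D E : Fin n) → identify D E E ≡ D
identify-at D E rewrite dec-true (E ≟ E) refl = refl

identify-off : ∀ {n} (D E : Fin n) {b} → b ≢ E → identify D E b ≡ b
identify-off D E {b} b≢E rewrite dec-false (b ≟ E) b≢E = refl

module _ {p q : ℕ} where

  nbhd : (Fin p → Subset q) → Subset p → Subset q
  nbhd N W = ⟪ (λ b → any? λ s → (s ∈? W) ×-dec (b ∈? N s)) ⟫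

  ∈-nbhd⁺ : ∀ N {W s b} → s ∈ W → b ∈ N s → b ∈ nbhd N W
  ∈-nbhd⁺ N {W} s∈W b∈ = ∈⟪⟫⁺ (λ b → any? λ s → (s ∈? W) ×-dec (b ∈? N s)) (_ , s∈W , b∈)

  ∈-nbhd⁻ : ∀ N {W b} → b ∈ nbhd N W → ∃ λ s → s ∈ W × b ∈ N s
  ∈-nbhd⁻ N {W} = ∈⟪⟫⁻ (λ b → any? λ s → (s ∈? W) ×-dec (b ∈? N s))

  nbhd-mono : ∀ N {W W′} → W ⊆ W′ → nbhd N W ⊆ nbhd N W′
  nbhd-mono N W⊆W′ b∈ with ∈-nbhd⁻ N b∈
  ... | s , s∈W , b∈Ns = ∈-nbhd⁺ N (W⊆W′ s∈W) b∈Ns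

  nbhd-∪ : ∀ N W W′ → nbhd N (W ∪ W′) ⊆ nbhd N W ∪ nbhd N W′
  nbhd-∪ N W W′ b∈ with ∈-nbhd⁻ N b∈
  ... | s , s∈ , b∈Ns with x∈p∪q⁻ W W′ s∈
  ... | inj₁ s∈W  = x∈p∪q⁺ (inj₁ (∈-nbhd⁺ N s∈W b∈Ns))
  ... | inj₂ s∈W′ = x∈p∪q⁺ (inj₂ (∈-nbhd⁺ N s∈W′ b∈Ns))

  -- The surplus of one is what guarantees every single part two different blocks.
  Hall : (Fin p → Subset q) → Subset p → Set
  Hall N F = ∀ W → W ⊆ F → Nonempty W → ∣ W ∣ < ∣ nbhd N W ∣

  -- Under `Hall N F` the last bound is an equality, so these are the sets without slack: the loss
  -- of one label breaks their condition.
  tight? : ∀ N F → Decidable (λ T → T ⊆ F × Nonempty T × ∣ nbhd N T ∣ ≤ suc ∣ T ∣)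
  tight? N F T = (T ⊆? F) ×-dec (nonempty? T ×-dec (∣ nbhd N T ∣ ≤? suc ∣ T ∣))

  -- Only the label `E` can disappear, so a drop to at most `∣ W ∣` starts from exactly `suc ∣ W ∣`.
  -- If `D` were not a neighbour before, it would replace `E` and the size would not drop.
  identification-tight : ∀ N {D E} W → D ≢ E → ∣ W ∣ < ∣ nbhd N W ∣ →
    ∣ nbhd (λ s → image (identify D E) (N s)) W ∣ ≤ ∣ W ∣ →
    D ∈ nbhd N W × E ∈ nbhd N W × ∣ nbhd N W ∣ ≤ suc ∣ W ∣
  identification-tight N {D} {E} W D≢E W<N N′≤W = D∈ , E∈ , N≤
    where
    N′ : Fin p → Subset q
    N′ s = image (identify D E) (N s)

    survive : ∀ {b} → b ∈ nbhd N W → b ≢ E → b ∈ nbhd N′ W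
    survive {b} b∈ b≢E with ∈-nbhd⁻ N b∈
    ... | s , s∈W , b∈Ns = ∈-nbhd⁺ N′ s∈W
      (subst (_∈ N′ s) (identify-off D E b≢E) (∈-image⁺ (identify D E) b∈Ns))

    E∈ : E ∈ nbhd N W
    E∈ = decidable-stable (E ∈? nbhd N W) λ E∉ → <-irrefl refl
      (<-≤-trans W<N (≤-trans (p⊆q⇒∣p∣≤∣q∣ (λ b∈ → survive b∈ λ { refl → E∉ b∈ })) N′≤W))

    D∈N′ : D ∈ nbhd N′ W
    D∈N′ with ∈-nbhd⁻ N E∈
    ... | s , s∈W , E∈Ns = ∈-nbhd⁺ N′ s∈W
      (subst (_∈ N′ s) (identify-at D E) (∈-image⁺ (identify D E) E∈Ns))

    D∈ : D ∈ nbhd N W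
    D∈ = decidable-stable (D ∈? nbhd N W) λ D∉ → <-irrefl refl (begin-strict
      ∣ W ∣                 <⟨ W<N ⟩
      ∣ nbhd N W ∣          ≤⟨ ∣p∣≤1+∣p-x∣ (nbhd N W) E ⟩
      suc ∣ nbhd N W - E ∣  ≤⟨ s≤s (p⊆q⇒∣p∣≤∣q∣ {q = nbhd N′ W - D} (λ b∈ →
                                 x∈p∧x≢y⇒x∈p-y (survive (p─q⊆p _ _ b∈) (∈-⇒≢ {p = nbhd N W} b∈))
                                   (λ { refl → D∉ (p─q⊆p _ _ b∈) }))) ⟩
      suc ∣ nbhd N′ W - D ∣ ≤⟨ x∈p⇒∣p-x∣<∣p∣ D∈N′ ⟩
      ∣ nbhd N′ W ∣         ≤⟨ N′≤W ⟩
      ∣ W ∣                 ∎)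
      where open ≤-Reasoning

    N≤ : ∣ nbhd N W ∣ ≤ suc ∣ W ∣
    N≤ = begin
      ∣ nbhd N W ∣         ≤⟨ ∣p∣≤1+∣p-x∣ (nbhd N W) E ⟩
      suc ∣ nbhd N W - E ∣ ≤⟨ s≤s (p⊆q⇒∣p∣≤∣q∣ (λ b∈ →
                                survive (p─q⊆p _ _ b∈) (∈-⇒≢ {p = nbhd N W} b∈))) ⟩
      suc ∣ nbhd N′ W ∣    ≤⟨ s≤s N′≤W ⟩
      suc ∣ W ∣            ∎
      where open ≤-Reasoning

  -- An identification of two labels in N s only threatens the tight sets containing both.
  -- With s in a minimal tight set T, submodularity of ∣ nbhd N _ ∣ excludes them all.
  exists-mergeable : ∀ N F → Hall N F → Nonempty F →
    ∃ λ s → s ∈ F × (∀ {D E} → D ∈ N s → E ∈ N s → D ≢ E →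
      Hall (λ t → image (identify D E) (N t)) (F - s))
  exists-mergeable N F hall (f , f∈F) with anySubset? (tight? N F)
  ... | no ¬tight = f , f∈F , λ {D} {E} D∈ E∈ D≢E W W⊆ ne →
    ≰⇒> λ N′≤W → ¬tight (W , p─q⊆p F ⁅ f ⁆ ∘ W⊆ , ne ,
      proj₂ (proj₂ (identification-tight N W D≢E (hall W (p─q⊆p F ⁅ f ⁆ ∘ W⊆) ne) N′≤W)))
  ... | yes tight with minimal-subset (tight? N F) ∣_∣ tight
  ... | T , (T⊆F , (s , s∈T) , T-tight) , T-min = s , T⊆F s∈T , preserved
    where
    preserved : ∀ {D E} → D ∈ N s → E ∈ N s → D ≢ E →
                Hall (λ t → image (identify D E) (N t)) (F - s)
    preserved {D} {E} D∈ E∈ D≢E W W⊆ ne = ≰⇒> broken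
      where
      W⊆F : W ⊆ F
      W⊆F = p─q⊆p F ⁅ s ⁆ ∘ W⊆

      broken : ¬ (∣ nbhd (λ t → image (identify D E) (N t)) W ∣ ≤ ∣ W ∣)
      broken N′≤W with identification-tight N W D≢E (hall W W⊆F ne) N′≤W
      -- Both cases contradict `∩-bound`. If `W` meets `T`, the intersection is smaller than `T`
      -- because `s` is outside `W`, hence it is not tight. If they are disjoint, the common labels
      -- `D` and `E` are already too many.
      ... | D∈A , E∈A , W-tight = case nonempty? (W ∩ T) of λ
        { (yes ne∩) → <-irrefl refl (begin-strict
            suc ∣ W ∩ T ∣            <⟨ ≰⇒> (λ ≤∩ → <⇒≱ W∩T<T
                                          (T-min (W ∩ T) (T⊆F ∘ p∩q⊆q W T , ne∩ , ≤∩))) ⟩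
            ∣ nbhd N (W ∩ T) ∣       ≤⟨ p⊆q⇒∣p∣≤∣q∣ (λ b∈ → x∈p∩q⁺
                                          (nbhd-mono N (p∩q⊆p W T) b∈ , nbhd-mono N (p∩q⊆q W T) b∈)) ⟩
            ∣ nbhd N W ∩ nbhd N T ∣  ≤⟨ ∩-bound ⟩
            suc ∣ W ∩ T ∣            ∎)
        ; (no e) → <-irrefl refl (begin-strict
            1                        <⟨ distinct⇒2≤∣p∣ (x∈p∩q⁺ (D∈A , ∈-nbhd⁺ N s∈T D∈))
                                          (x∈p∩q⁺ (E∈A , ∈-nbhd⁺ N s∈T E∈)) D≢E ⟩
            ∣ nbhd N W ∩ nbhd N T ∣  ≤⟨ ∩-bound ⟩
            suc ∣ W ∩ T ∣            ≡⟨ cong suc (empty⇒∣p∣≡0 e) ⟩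
            1                        ∎)
        }
        where
        open ≤-Reasoning

        W∩T<T : ∣ W ∩ T ∣ < ∣ T ∣
        W∩T<T = p⊂q⇒∣p∣<∣q∣ (p∩q⊆q W T , s , s∈T , λ s∈ → x∉p-x s F (W⊆ (p∩q⊆p W T s∈)))

        W∪T⊆F : W ∪ T ⊆ F
        W∪T⊆F x∈ = [ W⊆F , T⊆F ]′ (x∈p∪q⁻ W T x∈)

        -- Of the total surplus of at most two of `W` and `T`, the union takes at least one, so the
        -- intersection keeps at most one.
        ∩-bound : ∣ nbhd N W ∩ nbhd N T ∣ ≤ suc ∣ W ∩ T ∣
        ∩-bound = +-cancelˡ-≤ (suc ∣ W ∪ T ∣) _ _ (begin
          suc ∣ W ∪ T ∣ + ∣ nbhd N W ∩ nbhd N T ∣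
            ≤⟨ +-monoˡ-≤ _ (≤-trans (hall (W ∪ T) W∪T⊆F (s , x∈p∪q⁺ (inj₂ s∈T)))
                                    (p⊆q⇒∣p∣≤∣q∣ (nbhd-∪ N W T))) ⟩
          ∣ nbhd N W ∪ nbhd N T ∣ + ∣ nbhd N W ∩ nbhd N T ∣
            ≡⟨ ∣p∪q∣+∣p∩q∣≡∣p∣+∣q∣ (nbhd N W) (nbhd N T) ⟩
          ∣ nbhd N W ∣ + ∣ nbhd N T ∣
            ≤⟨ +-mono-≤ W-tight T-tight ⟩
          suc ∣ W ∣ + suc ∣ T ∣
            ≡⟨ cong suc (+-suc _ _) ⟩
          suc (suc (∣ W ∣ + ∣ T ∣))
            ≡⟨ cong (2 +_) (sym (∣p∪q∣+∣p∩q∣≡∣p∣+∣q∣ W T)) ⟩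
          suc (suc (∣ W ∪ T ∣ + ∣ W ∩ T ∣))
            ≡⟨ cong suc (+-suc _ _) ⟨
          suc ∣ W ∪ T ∣ + suc ∣ W ∩ T ∣ ∎)

  -- W is a largest set with ∣ nbhd N W ∣ ≤ ∣ W ∣.
  exists-deficient : ∀ N → p < ∣ nbhd N ⊤ ∣ →
    ∃ λ W → (∃ λ s → s ∉ W) ×
      (∀ U → U ⊆ ∁ W → Nonempty U → ∣ U ∣ < ∣ nbhd N U ─ nbhd N W ∣)
  -- A largest set is one with a smallest complement. The search starts at the empty set, whose
  -- neighbourhood is empty.
  exists-deficient N p<N with minimal-subset (λ W → ∣ nbhd N W ∣ ≤? ∣ W ∣) (λ W → ∣ ∁ W ∣)
    (⊥ , ≤-trans (≤-reflexive (empty⇒∣p∣≡0 λ (b , b∈) → ∉⊥ (proj₁ (proj₂ (∈-nbhd⁻ N b∈))))) z≤n)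
  ... | W , W-deficient , W-max = W , proper , surplus
    where
    proper : ∃ λ s → s ∉ W
    proper with any? (λ s → ¬? (s ∈? W))
    ... | yes p = p
    ... | no ¬p = contradiction (≤-trans W-deficient (∣p∣≤n W)) (<⇒≱ (<-≤-trans p<N
      (p⊆q⇒∣p∣≤∣q∣ (nbhd-mono N λ {s} _ → decidable-stable (s ∈? W) λ s∉ → ¬p (s , s∉)))))

    surplus : ∀ U → U ⊆ ∁ W → Nonempty U → ∣ U ∣ < ∣ nbhd N U ─ nbhd N W ∣
    -- Otherwise `W ∪ U` would be a larger deficient set.
    surplus U U⊆∁W (u , u∈U) = ≰⇒> λ N≤U → <⇒≱
      (p⊂q⇒∣p∣<∣q∣ (p⊂q⇒∁p⊃∁q (p⊆p∪q U , u , q⊆p∪q W U u∈U , x∈∁p⇒x∉p (U⊆∁W u∈U))))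
      (W-max (W ∪ U) (begin
        ∣ nbhd N (W ∪ U) ∣
          ≤⟨ p⊆q⇒∣p∣≤∣q∣ (cover ∘ nbhd-∪ N W U) ⟩
        ∣ nbhd N W ∪ (nbhd N U ─ nbhd N W) ∣
          ≤⟨ ∣p∪q∣≤∣p∣+∣q∣ (nbhd N W) _ ⟩
        ∣ nbhd N W ∣ + ∣ nbhd N U ─ nbhd N W ∣
          ≤⟨ +-mono-≤ W-deficient N≤U ⟩
        ∣ W ∣ + ∣ U ∣
          ≡⟨ ∣p∪q∣+∣p∩q∣≡∣p∣+∣q∣ W U ⟨
        ∣ W ∪ U ∣ + ∣ W ∩ U ∣
          ≡⟨ cong (∣ W ∪ U ∣ +_) (empty⇒∣p∣≡0 λ (x , x∈) →
               x∈∁p⇒x∉p (U⊆∁W (p∩q⊆q W U x∈)) (p∩q⊆p W U x∈)) ⟩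
        ∣ W ∪ U ∣ + 0
          ≡⟨ +-identityʳ _ ⟩
        ∣ W ∪ U ∣ ∎))
      where
      open ≤-Reasoning
      cover : nbhd N W ∪ nbhd N U ⊆ nbhd N W ∪ (nbhd N U ─ nbhd N W)
      cover {b} b∈ with b ∈? nbhd N W | x∈p∪q⁻ _ _ b∈
      ... | yes b∈W | _       = x∈p∪q⁺ (inj₁ b∈W)
      ... | no  b∉W | inj₁ b∈W = contradiction b∈W b∉W
      ... | no  b∉W | inj₂ b∈U = x∈p∪q⁺ (inj₂ (x∈p∧x∉q⇒x∈p─q b∈U b∉W))

  Hall⇒2≤ : ∀ N {F s} → Hall N F → s ∈ F → 2 ≤ ∣ N s ∣
  Hall⇒2≤ N {F} {s} hall s∈F =
    ≤-trans (subst (λ k → suc k ≤ ∣ nbhd N ⁅ s ⁆ ∣) (∣⁅x⁆∣≡1 s)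
      (hall ⁅ s ⁆ (λ x∈ → subst (_∈ F) (sym (x∈⁅y⁆⇒x≡y s x∈)) s∈F) (s , x∈⁅x⁆ s)))
    (p⊆q⇒∣p∣≤∣q∣ λ b∈ → let (t , t∈ , b∈Nt) = ∈-nbhd⁻ N b∈ in
      subst (λ t → _ ∈ N t) (x∈⁅y⁆⇒x≡y s t∈) b∈Nt)

-- Peelings and greedy colouring

_[_≔_] : ∀ {n} {A : Set} → (Fin n → A) → Fin n → A → Fin n → A
f [ z ≔ a ] = updateAt f z (const a)

≔-at : ∀ {n} {A : Set} (f : Fin n → A) z {a} → (f [ z ≔ a ]) z ≡ a
≔-at f z = updateAt-updates z f

≔-off : ∀ {n} {A : Set} (f : Fin n → A) {z u a} → u ≢ z → (f [ z ≔ a ]) u ≡ f u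
≔-off f {z} {u} u≢z = updateAt-minimal u z f u≢z

bounded : ∀ {n} (f : Fin n → ℕ) → ∃ λ N → ∀ u → f u < N
bounded {zero}  f = 0 , λ ()
bounded {suc n} f with bounded (f ∘ suc)
... | N , f<N = suc (f zero) ⊔ N , λ
  { zero    → m≤m⊔n (suc (f zero)) N
  ; (suc u) → ≤-trans (f<N u) (m≤n⊔m (suc (f zero)) N) }

-- Tripled heights leave two free levels strictly between any two old ones; vertices and blocks are
-- moved into these.
3*-< : ∀ {a b} → a < b → suc (suc (suc (3 * a))) ≤ 3 * b
3*-< {a} {b} a<b = subst (_≤ 3 * b) (*-suc 3 a) (*-monoʳ-≤ 3 a<b)

module _ {n m : ℕ} {A : Subset n} (ψ : Fin n → Fin m)
         (pick : ∀ c → ∃ λ u → u ∈ A × ψ u ≡ c) where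

  private
    pick-injective : Injective _≡_ _≡_ (λ c → proj₁ (pick c))
    pick-injective {c} {d} e =
      trans (sym (proj₂ (proj₂ (pick c)))) (trans (cong ψ e) (proj₂ (proj₂ (pick d))))

  -- The representatives of different colours are different vertices.
  all-colours⇒≤ : m ≤ ∣ A ∣
  all-colours⇒≤ = injection⇒≤∣p∣ m _ pick-injective (λ c → proj₁ (proj₂ (pick c)))

  all-colours-extra⇒< : ∀ {w} → w ∈ A → (∀ c → proj₁ (pick c) ≢ w) → m < ∣ A ∣
  all-colours-extra⇒< {w} w∈A unpicked =
    injection⇒≤∣p∣ (suc m) f (λ {i} {j} → f-injective i j) f∈A
    where
    f : Fin (suc m) → Fin n
    f zero    = w
    f (suc c) = proj₁ (pick c)

    f-injective : ∀ i j → f i ≡ f j → i ≡ j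
    f-injective zero    zero    e = refl
    f-injective zero    (suc d) e = contradiction (sym e) (unpicked d)
    f-injective (suc c) zero    e = contradiction e (unpicked c)
    f-injective (suc c) (suc d) e = cong suc (pick-injective e)

    f∈A : ∀ i → f i ∈ A
    f∈A zero    = w∈A
    f∈A (suc c) = proj₁ (proj₂ (pick c))

  -- At most one of `w` and `w′` represents their common colour; the other one is an extra element.
  all-colours-repeat⇒< : ∀ {w w′} → w ∈ A → w′ ∈ A → w ≢ w′ → ψ w ≡ ψ w′ → m < ∣ A ∣
  all-colours-repeat⇒< {w} {w′} w∈A w′∈A w≢w′ same with proj₁ (pick (ψ w)) ≟ w
  ... | yes eq = all-colours-extra⇒< w′∈A λ c e → w≢w′ (trans (sym eq)
    (trans (cong (proj₁ ∘ pick) (trans same (trans (cong ψ (sym e)) (proj₂ (proj₂ (pick c)))))) e))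
  ... | no neq = all-colours-extra⇒< w∈A λ c e → neq
    (trans (cong (proj₁ ∘ pick) (trans (cong ψ (sym e)) (proj₂ (proj₂ (pick c))))) e)

module _ (G : Digraph) where
  open Digraph G

  Adj : Fin n → Fin n → Set
  Adj u v = Arc G u v ⊎ Arc G v u

  arc? : ∀ u v → Dec (Arc G u v)
  arc? u v = arc u v Bool.≟ true

  adj? : ∀ u v → Dec (Adj u v)
  adj? u v = arc? u v ⊎-dec arc? v u

  no-loop : ∀ {u} → ¬ Arc G u u
  no-loop {u} a = case trans (sym a) (loopless u) of λ ()

  -- Each vertex of the list has a neighbour further on in L ∷ʳ r, so that
  -- colouring along L always leaves an uncoloured neighbour.
  data PeelsTo : List (Fin n) → Fin n → Set where
    []   : ∀ {r} → PeelsTo [] r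
    peel : ∀ {z w L r} → Adj z w → w List.∈ L ∷ʳ r → PeelsTo L r → PeelsTo (z ∷ L) r

  peels-∷ʳ : ∀ {L r z} → PeelsTo L r → Adj r z → PeelsTo (L ∷ʳ r) z
  peels-∷ʳ []              r~z = peel r~z (here refl) []
  peels-∷ʳ (peel x~y y∈ P) r~z = peel x~y (++⁺ˡ y∈) (peels-∷ʳ P r~z)

  -- To end at the head `z`, first let the tail end at a neighbour `w` of `z`, then append `z` as
  -- the later neighbour of `w`. A head that stays in front keeps its later neighbour, since the
  -- tail is only permuted.
  reroot : ∀ {L r v} → PeelsTo L r → v List.∈ L ∷ʳ r →
           ∃ λ L′ → PeelsTo L′ v × L′ ∷ʳ v ↭ L ∷ʳ r
  reroot [] (here refl) = [] , [] , ↭-refl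
  reroot (peel {z} z~w w∈ P) (here refl) with reroot P w∈
  ... | L₁ , P₁ , perm = L₁ ∷ʳ _ , peels-∷ʳ P₁ (Sum.swap z~w) ,
        ↭-trans (↭-sym (∷↭∷ʳ z (L₁ ∷ʳ _))) (prep z perm)
  reroot (peel {z} z~w w∈ P) (there v∈) with reroot P v∈
  ... | L₁ , P₁ , perm = z ∷ L₁ , peel z~w (∈-resp-↭ (↭-sym perm) w∈) P₁ , prep z perm

  private
    module ListDec = Data.List.Membership.DecPropositional (_≟_ {n})

  -- A search from `v` inside `Y`: each vertex found is put in front, so the neighbour through which
  -- it was found comes later. In `grow`, the set `R` holds the vertices of `Y` not yet listed, and
  -- `k` bounds its size.
  reachable-peeling : ∀ Y {v} → v ∈ Y → ∃ λ L → PeelsTo L v × Unique (L ∷ʳ v) ×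
    (∀ {x} → x List.∈ L ∷ʳ v → x ∈ Y) ×
    (∀ {x y} → x List.∈ L ∷ʳ v → y ∈ Y → Adj x y → y List.∈ L ∷ʳ v)
  reachable-peeling Y {v} v∈Y = grow ∣ Y - v ∣ (Y - v) ≤-refl (p─q⊆p Y ⁅ v ⁆) [] [] ([] ∷ [])
    (λ { (here refl) → v∈Y })
    (λ { (here refl) → x∉p-x v Y })
    (λ {y} y∈Y → case y ≟ v of λ { (yes refl) → inj₂ (here refl)
                                 ; (no y≢v) → inj₁ (x∈p∧x≢y⇒x∈p-y y∈Y y≢v) })
    where
    grow : ∀ k R → ∣ R ∣ ≤ k → R ⊆ Y → ∀ L → PeelsTo L v → Unique (L ∷ʳ v) →
      (∀ {x} → x List.∈ L ∷ʳ v → x ∈ Y) → (∀ {x} → x List.∈ L ∷ʳ v → x ∉ R) →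
      (∀ {y} → y ∈ Y → y ∈ R ⊎ y List.∈ L ∷ʳ v) →
      ∃ λ L → PeelsTo L v × Unique (L ∷ʳ v) ×
        (∀ {x} → x List.∈ L ∷ʳ v → x ∈ Y) ×
        (∀ {x y} → x List.∈ L ∷ʳ v → y ∈ Y → Adj x y → y List.∈ L ∷ʳ v)
    grow k R R≤k R⊆Y L P uniq L⊆Y L∉R cover
      with any? (λ y → any? λ x → (y ∈? R) ×-dec ((x ListDec.∈? (L ∷ʳ v)) ×-dec adj? y x))
    ... | no ¬next = L , P , uniq , L⊆Y , λ x∈ y∈Y x~y →
      [ (λ y∈R → contradiction (_ , _ , y∈R , x∈ , Sum.swap x~y) ¬next) , (λ y∈ → y∈) ]′ (cover y∈Y)
    grow zero R R≤k R⊆Y L P uniq L⊆Y L∉R cover | yes (y , x , y∈R , x∈ , y~x) =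
      contradiction (<-≤-trans (≤-<-trans z≤n (x∈p⇒∣p-x∣<∣p∣ y∈R)) R≤k) λ ()
    grow (suc k) R R≤k R⊆Y L P uniq L⊆Y L∉R cover | yes (y , x , y∈R , x∈ , y~x) =
      grow k (R - y) (s≤s⁻¹ (<-≤-trans (x∈p⇒∣p-x∣<∣p∣ y∈R) R≤k)) (R⊆Y ∘ p─q⊆p R ⁅ y ⁆)
        (y ∷ L) (peel y~x x∈ P) (All.tabulate (λ { x∈ refl → L∉R x∈ y∈R }) ∷ uniq)
        (λ { (here refl) → R⊆Y y∈R ; (there x∈) → L⊆Y x∈ })
        (λ { (here refl) → x∉p-x y R ; (there x∈) → L∉R x∈ ∘ p─q⊆p R ⁅ y ⁆ })
        (λ {z} z∈Y → case z ≟ y of λ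
          { (yes refl) → inj₂ (here refl)
          ; (no z≢y) → Sum.map (λ z∈R → x∈p∧x≢y⇒x∈p-y z∈R z≢y) there (cover z∈Y) })

  module _ {m : ℕ} where

    -- Given the colour `c`, the vertex `z` is a source (respectively a sink) of its colour class
    -- among the vertices of `K`, so it closes no monochromatic cycle.
    NoIn NoOut : (Fin n → Fin m) → (Fin n → Set) → Fin n → Fin m → Set
    NoIn  ψ K z c = ∀ {u} → K u → Arc G u z → ψ u ≢ c
    NoOut ψ K z c = ∀ {u} → K u → Arc G z u → ψ u ≢ c

    Saturated : (Fin n → Fin m) → (Fin n → Set) → Fin n → Set
    Saturated ψ K z = ∀ c → (∃ λ u → (K u × Arc G u z) × ψ u ≡ c) ×
                            (∃ λ u → (K u × Arc G z u) × ψ u ≡ c)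

    free-colour? : ∀ ψ {K} → Decidable K → ∀ z →
      (∃ λ c → NoIn ψ K z c ⊎ NoOut ψ K z c) ⊎ Saturated ψ K z
    free-colour? ψ {K} K? z with any? (λ c → ¬? (in? c) ⊎-dec ¬? (out? c))
      where
      in? : ∀ c → Dec (∃ λ u → (K u × Arc G u z) × ψ u ≡ c)
      in? c = any? λ u → (K? u ×-dec arc? u z) ×-dec (ψ u ≟ c)
      out? : ∀ c → Dec (∃ λ u → (K u × Arc G z u) × ψ u ≡ c)
      out? c = any? λ u → (K? u ×-dec arc? z u) ×-dec (ψ u ≟ c)
    ... | yes (c , inj₁ ¬in)  = inj₁ (c , inj₁ λ Ku a e → ¬in (_ , (Ku , a) , e))
    ... | yes (c , inj₂ ¬out) = inj₁ (c , inj₂ λ Ku a e → ¬out (_ , (Ku , a) , e))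
    ... | no ¬free = inj₂ λ c →
      decidable-stable (any? λ u → (K? u ×-dec arc? u z) ×-dec (ψ u ≟ c)) (λ ¬in → ¬free (c , inj₁ ¬in)) ,
      decidable-stable (any? λ u → (K? u ×-dec arc? z u) ×-dec (ψ u ≟ c)) (λ ¬out → ¬free (c , inj₂ ¬out))

    private
      ins outs : Fin n → Subset n
      ins  z = tabulate (λ v → arc v z)
      outs z = tabulate (λ v → arc z v)

      ∈-ins : ∀ {z u} → Arc G u z → u ∈ ins z
      ∈-ins {u = u} a = lookup⇒[]= u _ (trans (lookup∘tabulate _ u) a)

      ∈-outs : ∀ {z u} → Arc G z u → u ∈ outs z
      ∈-outs {u = u} a = lookup⇒[]= u _ (trans (lookup∘tabulate _ u) a)

    module _ {ψ : Fin n → Fin m} {K : Fin n → Set} {z : Fin n}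
             (deg≤ : deg G z ≤ 2 * m) (sat : Saturated ψ K z) where

      private
        pick-in : ∀ c → ∃ λ u → u ∈ ins z × ψ u ≡ c
        pick-in c with u , (_ , a) , e ← proj₁ (sat c) = u , ∈-ins a , e

        pick-out : ∀ c → ∃ λ u → u ∈ outs z × ψ u ≡ c
        pick-out c with u , (_ , a) , e ← proj₂ (sat c) = u , ∈-outs a , e

        degree-bound : outdeg G z + indeg G z ≤ m + m
        degree-bound = subst (deg G z ≤_) (cong (m +_) (+-identityʳ m)) deg≤

        ins≤ : ¬ m < ∣ ins z ∣
        ins≤ m<in = <⇒≱ (+-mono-≤-< (all-colours⇒≤ ψ pick-out) m<in) degree-bound

        outs≤ : ¬ m < ∣ outs z ∣
        outs≤ m<out = <⇒≱ (+-mono-<-≤ m<out (all-colours⇒≤ ψ pick-in)) degree-bound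

      -- Every colour takes an in-neighbour and an out-neighbour, which exhausts the degree `2 * m`:
      -- each side has exactly one neighbour of each colour. An uncoloured neighbour, or a repeated
      -- colour on one side, would exceed this.
      saturated-all-coloured : ∀ {w} → Adj z w → ¬ ¬ K w
      saturated-all-coloured (inj₁ a) ¬Kw = outs≤ (all-colours-extra⇒< ψ pick-out (∈-outs a)
        λ c e → ¬Kw (subst K e (proj₁ (proj₁ (proj₂ (proj₂ (sat c)))))))
      saturated-all-coloured (inj₂ a) ¬Kw = ins≤ (all-colours-extra⇒< ψ pick-in (∈-ins a)
        λ c e → ¬Kw (subst K e (proj₁ (proj₁ (proj₂ (proj₁ (sat c)))))))

      saturated-in-unique : ∀ {u u′} → Arc G u z → Arc G u′ z → ψ u ≡ ψ u′ → u ≡ u′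
      saturated-in-unique {u} {u′} a a′ e = decidable-stable (u ≟ u′) λ u≢u′ →
        ins≤ (all-colours-repeat⇒< ψ pick-in (∈-ins a) (∈-ins a′) u≢u′ e)

      saturated-out-unique : ∀ {u u′} → Arc G z u → Arc G z u′ → ψ u ≡ ψ u′ → u ≡ u′
      saturated-out-unique {u} {u′} a a′ e = decidable-stable (u ≟ u′) λ u≢u′ →
        outs≤ (all-colours-repeat⇒< ψ pick-out (∈-outs a) (∈-outs a′) u≢u′ e)

    free-colour : ∀ ψ {K} → Decidable K → ∀ {z w} → deg G z ≤ 2 * m → Adj z w → ¬ K w →
      ∃ λ c → NoIn ψ K z c ⊎ NoOut ψ K z c
    free-colour ψ K? {z} deg≤ z~w ¬Kw with free-colour? ψ K? z
    ... | inj₁ free = free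
    ... | inj₂ sat  = contradiction ¬Kw (saturated-all-coloured deg≤ sat z~w)

-- Colourings relative to blocks

transpose-injective : ∀ {n} (i j : Fin n) {k l} → transpose i j k ≡ transpose i j l → k ≡ l
transpose-injective i j {k} {l} e =
  trans (sym (transpose-inverse j i)) (trans (cong (transpose j i) e) (transpose-inverse j i))

transpose-at : ∀ {n} (i j : Fin n) → transpose i j i ≡ j
transpose-at i j rewrite dec-true (i ≟ i) refl = refl

map₁-inj₁⁻ : ∀ {A B C : Set} (f : A → B) (s : A ⊎ C) {b} →
             Sum.map₁ f s ≡ inj₁ b → ∃ λ a → s ≡ inj₁ a × f a ≡ b
map₁-inj₁⁻ f (inj₁ a) refl = a , refl , refl

map₁-inj₂⁻ : ∀ {A B C : Set} (f : A → B) (s : A ⊎ C) {c} → Sum.map₁ f s ≡ inj₂ c → s ≡ inj₂ c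
map₁-inj₂⁻ f (inj₂ c) refl = refl

inj₁≢inj₂ : ∀ {A B : Set} {a : A} {b : B} {s : A ⊎ B} → s ≡ inj₁ a → s ≢ inj₂ b
inj₁≢inj₂ refl ()

∈-∷ʳ⁻ : ∀ {A : Set} (L : List A) {r u} → u List.∈ L ∷ʳ r → u List.∈ L ⊎ u ≡ r
∈-∷ʳ⁻ L u∈ with ++⁻ L u∈
... | inj₁ u∈L       = inj₁ u∈L
... | inj₂ (here eq) = inj₂ eq

-- A label inj₁ b puts a vertex into the block b, whose colouring φ is only fixed up to a
-- permutation of the colours; inj₂ s says that it belongs to the uncoloured component s.
Labelling : Digraph → ℕ → ℕ → Set
Labelling G Q p = Fin (Digraph.n G) → Fin Q ⊎ Fin p

module _ (G : Digraph) {Q p : ℕ} where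
  open Digraph G

  Same : Labelling G Q p → Fin n → Fin n → Set
  Same lab u v = ∃ λ d → lab u ≡ inj₁ d × lab v ≡ inj₁ d

  Done : Labelling G Q p → Fin n → Set
  Done lab u = ∃ λ d → lab u ≡ inj₁ d

  done? : ∀ lab → Decidable (Done lab)
  done? lab u = any? λ d → ≡-dec _≟_ _≟_ (lab u) (inj₁ d)

  merge-labels : Fin Q → Fin Q → Labelling G Q p → Labelling G Q p
  merge-labels D E lab u = Sum.map₁ (identify D E) (lab u)

module _ (G : Digraph) {m Q p : ℕ} where
  open Digraph G

  -- A colouring of the vertices in K whose quotient by the blocks is acyclic, as
  -- witnessed by the heights.
  record Colouring (lab : Labelling G Q p) (φ : Fin n → Fin m) (K : Fin n → Set) : Set where
    field
      ψ      : Fin n → Fin m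
      height : Fin n → ℕ
      -- With `mono⁻`: inside one block `φ` and `ψ` have the same colour classes, so they differ
      -- there by a permutation of the colours.
      mono⁺  : ∀ {u v} → Same G lab u v → φ u ≡ φ v → ψ u ≡ ψ v
      mono⁻  : ∀ {u v} → Same G lab u v → ψ u ≡ ψ v → φ u ≡ φ v
      level  : ∀ {u v} → Same G lab u v → height u ≡ height v
      incr   : ∀ {u v} → K u → K v → Arc G u v → ψ u ≡ ψ v → Same G lab u v ⊎ height u < height v

  weaken : ∀ {lab φ K K′} → (∀ {u} → K′ u → K u) → Colouring lab φ K → Colouring lab φ K′
  weaken K′⊆K C = record { Colouring C ; incr = λ Ku Kv → Colouring.incr C (K′⊆K Ku) (K′⊆K Kv) }

  private
    otherwise : ∀ {A B : Set} → A ⊎ B → ¬ A → B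
    otherwise (inj₁ a) ¬a = contradiction a ¬a
    otherwise (inj₂ b) _  = b

    same≢ˡ : ∀ {lab : Labelling G Q p} {z s u v} → lab z ≡ inj₂ s → Same G lab u v → u ≢ z
    same≢ˡ z-undone (d , u∈d , _) refl = inj₁≢inj₂ u∈d z-undone

    same≢ʳ : ∀ {lab : Labelling G Q p} {z s u v} → lab z ≡ inj₂ s → Same G lab u v → v ≢ z
    same≢ʳ z-undone (d , _ , v∈d) refl = inj₁≢inj₂ v∈d z-undone

  -- A source is put at height `0` below all other heights, which move up by one; a sink is put
  -- above all heights. As `z` lies in no block, the conditions on blocks are unaffected.
  colour-free : ∀ {lab φ K z s c} (C : Colouring lab φ K) → lab z ≡ inj₂ s →
    let open Colouring C in NoIn G ψ K z c ⊎ NoOut G ψ K z c →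
    Colouring lab φ (λ u → u ≡ z ⊎ K u)
  colour-free {lab} {φ} {K} {z} {s} {c} C z-undone free = record
    { ψ = ψ [ z ≔ c ]
    ; height = proj₁ (new-height-from free)
    ; mono⁺ = λ same e → trans (≔-off ψ (same≢ˡ z-undone same))
        (trans (mono⁺ same e) (sym (≔-off ψ (same≢ʳ z-undone same))))
    ; mono⁻ = λ same e → mono⁻ same (trans (sym (≔-off ψ (same≢ˡ z-undone same)))
        (trans e (≔-off ψ (same≢ʳ z-undone same))))
    ; level = proj₁ (proj₂ (new-height-from free))
    ; incr = λ Ku Kv a e → proj₂ (proj₂ (new-height-from free)) Ku Kv a e
    }
    where
    open Colouring C

    new-height-from : NoIn G ψ K z c ⊎ NoOut G ψ K z c → ∃ λ (h : Fin n → ℕ) → (∀ {u v} → Same G lab u v → h u ≡ h v) ×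
      (∀ {u v} → u ≡ z ⊎ K u → v ≡ z ⊎ K v → Arc G u v → (ψ [ z ≔ c ]) u ≡ (ψ [ z ≔ c ]) v →
        Same G lab u v ⊎ h u < h v)
    new-height-from (inj₁ no-in) = h , h-level , h-incr
      where
      h : Fin n → ℕ
      h = (suc ∘ height) [ z ≔ 0 ]

      h-level : ∀ {u v} → Same G lab u v → h u ≡ h v
      h-level same = trans (≔-off (suc ∘ height) (same≢ˡ z-undone same))
        (trans (cong suc (level same)) (sym (≔-off (suc ∘ height) (same≢ʳ z-undone same))))

      h-incr : ∀ {u v} → u ≡ z ⊎ K u → v ≡ z ⊎ K v → Arc G u v →
        (ψ [ z ≔ c ]) u ≡ (ψ [ z ≔ c ]) v → Same G lab u v ⊎ h u < h v
      h-incr {u} {v} Ku Kv a e with u ≟ z | v ≟ z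
      ... | yes refl | yes refl = contradiction a (no-loop G)
      ... | yes refl | no v≢z = inj₂ (subst₂ _<_ (sym (≔-at (suc ∘ height) z))
              (sym (≔-off (suc ∘ height) v≢z)) z<s)
      ... | no u≢z | yes refl = contradiction
              (trans (sym (≔-off ψ u≢z)) (trans e (≔-at ψ z))) (no-in (otherwise Ku u≢z) a)
      ... | no u≢z | no v≢z = Sum.map₂
              (λ lt → subst₂ _<_ (sym (≔-off (suc ∘ height) u≢z)) (sym (≔-off (suc ∘ height) v≢z)) (s≤s lt))
              (incr (otherwise Ku u≢z) (otherwise Kv v≢z) a (trans (sym (≔-off ψ u≢z)) (trans e (≔-off ψ v≢z))))
    new-height-from (inj₂ no-out) = h , h-level , h-incr
      where
      top : ∃ λ N → ∀ u → height u < N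
      top = bounded height

      h : Fin n → ℕ
      h = height [ z ≔ proj₁ top ]

      h-level : ∀ {u v} → Same G lab u v → h u ≡ h v
      h-level same = trans (≔-off height (same≢ˡ z-undone same))
        (trans (level same) (sym (≔-off height (same≢ʳ z-undone same))))

      h-incr : ∀ {u v} → u ≡ z ⊎ K u → v ≡ z ⊎ K v → Arc G u v →
        (ψ [ z ≔ c ]) u ≡ (ψ [ z ≔ c ]) v → Same G lab u v ⊎ h u < h v
      h-incr {u} {v} Ku Kv a e with u ≟ z | v ≟ z
      ... | yes refl | yes refl = contradiction a (no-loop G)
      ... | yes refl | no v≢z = contradiction
              (trans (sym (≔-off ψ v≢z)) (trans (sym e) (≔-at ψ z))) (no-out (otherwise Kv v≢z) a)
      ... | no u≢z | yes refl = inj₂ (subst₂ _<_ (sym (≔-off height u≢z))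
              (sym (≔-at height z)) (proj₂ top u))
      ... | no u≢z | no v≢z = Sum.map₂
              (λ lt → subst₂ _<_ (sym (≔-off height u≢z)) (sym (≔-off height v≢z)) lt)
              (incr (otherwise Ku u≢z) (otherwise Kv v≢z) a (trans (sym (≔-off ψ u≢z)) (trans e (≔-off ψ v≢z))))

  -- Each vertex is coloured while a later neighbour is still uncoloured, so it is not saturated.
  -- The end `r` serves only as such a neighbour and remains uncoloured.
  colour-along : ∀ {lab φ K L r} → PeelsTo G L r → Unique (L ∷ʳ r) → Decidable K →
    (∀ {x} → x List.∈ L ∷ʳ r → ¬ K x × (∃ λ s → lab x ≡ inj₂ s) × deg G x ≤ 2 * m) →
    Colouring lab φ K → Colouring lab φ (λ u → u List.∈ L ⊎ K u)
  colour-along [] uniq K? new C = weaken (λ { (inj₂ k) → k }) C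
  colour-along {K = K} (peel {z} z~w w∈ P) (z∉ ∷ uniq) K? new C
    with (_ , (s , z-undone) , deg≤) ← new (here refl)
    with free-colour G (Colouring.ψ C) K? deg≤ z~w (proj₁ (new (there w∈)))
  ... | c , free = weaken
    (λ { (inj₁ (here e)) → inj₂ (inj₁ e) ; (inj₁ (there u∈)) → inj₁ u∈ ; (inj₂ k) → inj₂ (inj₂ k) })
    (colour-along P uniq (λ u → (u ≟ z) ⊎-dec K? u)
      (λ x∈ → (λ { (inj₁ refl) → All.lookup z∉ x∈ refl ; (inj₂ k) → proj₁ (new (there x∈)) k })
             , proj₂ (new (there x∈)))
      (colour-free C z-undone free))

  -- Exchanges two colours on the block `E` alone, one of the permutations that a `Colouring` leaves
  -- open.
  shift : Fin Q → Fin m → Fin m → Fin Q ⊎ Fin p → Fin m → Fin m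
  shift E i j (inj₁ d) = if does (d ≟ E) then transpose i j else λ c → c
  shift E i j (inj₂ s) = λ c → c

  shift-injective : ∀ E i j l {c c′} → shift E i j l c ≡ shift E i j l c′ → c ≡ c′
  shift-injective E i j (inj₁ d) e with does (d ≟ E)
  ... | true  = transpose-injective i j e
  ... | false = e
  shift-injective E i j (inj₂ s) e = e

  -- The conditions for the glued block imply those for its two halves: `shift` is injective on each
  -- half, and by `done-arc` no arc runs between them. The exchange gave `y` the colour of `x`
  -- inside the glued block, hence the equal colours and heights.
  split-blocks : ∀ {lab φ K D E x y} → D ≢ E → lab x ≡ inj₁ D → lab y ≡ inj₁ E →
    (∀ {u v d e} → Adj G u v → lab u ≡ inj₁ d → lab v ≡ inj₁ e → d ≡ e) →
    Colouring (merge-labels G D E lab) (λ u → shift E (φ y) (φ x) (lab u) (φ u)) K →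
    Σ (Colouring lab φ K) λ C → let open Colouring C in ψ x ≡ ψ y × height x ≡ height y
  split-blocks {lab} {φ} {K} {D} {E} {x} {y} D≢E x∈D y∈E done-arc C =
    record
      { ψ = ψ
      ; height = height
      ; mono⁺ = λ { {u} {v} same@(d , u∈d , v∈d) e →
          mono⁺ (merged same) (cong₂ (shift E (φ y) (φ x)) (trans u∈d (sym v∈d)) e) }
      ; mono⁻ = λ { {u} {v} same@(d , u∈d , v∈d) e → shift-injective E (φ y) (φ x) (lab u)
          (trans (mono⁻ (merged same) e)
                 (cong (λ l → shift E (φ y) (φ x) l (φ v)) (trans v∈d (sym u∈d)))) }
      ; level = λ same → level (merged same)
      ; incr = λ {u} {v} Ku Kv a e → Sum.map₁ (λ { (d , u∈d , v∈d) →
          let u-done = map₁-inj₁⁻ (identify D E) (lab u) u∈d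
              v-done = map₁-inj₁⁻ (identify D E) (lab v) v∈d
          in proj₁ u-done , proj₁ (proj₂ u-done) ,
             trans (proj₁ (proj₂ v-done)) (cong inj₁
               (sym (done-arc (inj₁ a) (proj₁ (proj₂ u-done)) (proj₁ (proj₂ v-done))))) })
          (incr Ku Kv a e)
      }
    , mono⁺ xy-merged xy-colour , level xy-merged
    where
    open Colouring C

    merged : ∀ {u v} → Same G lab u v → Same G (merge-labels G D E lab) u v
    merged (d , u∈d , v∈d) = identify D E d ,
      cong (Sum.map₁ (identify D E)) u∈d , cong (Sum.map₁ (identify D E)) v∈d

    xy-merged : Same G (merge-labels G D E lab) x y
    xy-merged = D , trans (cong (Sum.map₁ (identify D E)) x∈D) (cong inj₁ (identify-off D E D≢E)) ,
      trans (cong (Sum.map₁ (identify D E)) y∈E) (cong inj₁ (identify-at D E))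

    xy-colour : shift E (φ y) (φ x) (lab x) (φ x) ≡ shift E (φ y) (φ x) (lab y) (φ y)
    xy-colour rewrite x∈D | y∈E | dec-false (D ≟ E) D≢E | dec-true (E ≟ E) refl =
      sym (transpose-at (φ y) (φ x))

  -- Inserting v strictly between the equally high blocks of y and x.
  colour-between : ∀ {lab φ K v s x y D E} (C : Colouring lab φ K) → let open Colouring C in
    lab v ≡ inj₂ s → D ≢ E → lab x ≡ inj₁ D → lab y ≡ inj₁ E →
    Arc G y v → Arc G v x → ψ x ≡ ψ y → height x ≡ height y →
    (∀ {u} → K u → Arc G u v → ψ u ≡ ψ y → u ≡ y) →
    (∀ {u} → K u → Arc G v u → ψ u ≡ ψ x → u ≡ x) →
    Colouring lab φ (λ u → u ≡ v ⊎ K u)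
  colour-between {lab} {φ} {K} {v} {s} {x} {y} {D} {E} C v-undone D≢E x∈D y∈E y→v v→x ψxy hxy
    in-unique out-unique = record
    { ψ = ψ [ v ≔ ψ x ]
    ; height = h
    ; mono⁺ = λ same e → trans (≔-off ψ (same≢ˡ v-undone same))
        (trans (mono⁺ same e) (sym (≔-off ψ (same≢ʳ v-undone same))))
    ; mono⁻ = λ same e → mono⁻ same (trans (sym (≔-off ψ (same≢ˡ v-undone same)))
        (trans e (≔-off ψ (same≢ʳ v-undone same))))
    ; level = λ { {u} {w} same@(d , u∈d , w∈d) → trans (h-off (same≢ˡ v-undone same))
        (trans (cong₂ (λ l k → raise l + 3 * k) (trans u∈d (sym w∈d)) (level same))
               (sym (h-off (same≢ʳ v-undone same)))) }
    ; incr = h-incr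
    }
    where
    open Colouring C

    -- Within the tripled common level of `x` and `y`, the block `E` keeps offset `0`, `v` gets `1`
    -- and the block `D` gets `2`, so both arcs `y` to `v` and `v` to `x` go up.
    raise : Fin Q ⊎ Fin p → ℕ
    raise (inj₁ d) = if does (d ≟ D) then 2 else 0
    raise (inj₂ _) = 0

    raise≤2 : ∀ l → raise l ≤ 2
    raise≤2 (inj₁ d) with does (d ≟ D)
    ... | true  = ≤-refl
    ... | false = z≤n
    raise≤2 (inj₂ _) = z≤n

    raise-D : raise (inj₁ D) ≡ 2
    raise-D rewrite dec-true (D ≟ D) refl = refl

    raise-E : raise (inj₁ E) ≡ 0
    raise-E rewrite dec-false (E ≟ D) (D≢E ∘ sym) = refl

    raised : Fin n → ℕ
    raised u = raise (lab u) + 3 * height u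

    h : Fin n → ℕ
    h = raised [ v ≔ suc (3 * height x) ]

    h-off : ∀ {u} → u ≢ v → h u ≡ raised u
    h-off = ≔-off raised

    x≢v : x ≢ v
    x≢v refl = inj₁≢inj₂ x∈D v-undone

    y≢v : y ≢ v
    y≢v refl = inj₁≢inj₂ y∈E v-undone

    h-incr : ∀ {u w} → u ≡ v ⊎ K u → w ≡ v ⊎ K w → Arc G u w →
      (ψ [ v ≔ ψ x ]) u ≡ (ψ [ v ≔ ψ x ]) w → Same G lab u w ⊎ h u < h w
    h-incr {u} {w} Ku Kw a e with u ≟ v | w ≟ v
    ... | yes refl | yes refl = contradiction a (no-loop G)
    ... | yes refl | no w≢v
      with refl ← out-unique (otherwise Kw w≢v) a (trans (sym (≔-off ψ w≢v)) (trans (sym e) (≔-at ψ v))) =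
      inj₂ (subst₂ _<_ (sym (≔-at raised v))
        (sym (trans (h-off x≢v) (cong (_+ 3 * height x) (trans (cong raise x∈D) raise-D)))) ≤-refl)
    ... | no u≢v | yes refl
      with refl ← in-unique (otherwise Ku u≢v) a
             (trans (sym (≔-off ψ u≢v)) (trans e (trans (≔-at ψ v) ψxy))) =
      inj₂ (subst₂ _<_
        (sym (trans (h-off y≢v) (cong₂ (λ l k → raise l + 3 * k) y∈E (sym hxy))))
        (sym (≔-at raised v)) (subst (λ r → r + 3 * height x < suc (3 * height x)) (sym raise-E) ≤-refl))
    ... | no u≢v | no w≢v = Sum.map₂
      (λ lt → subst₂ _<_ (sym (h-off u≢v)) (sym (h-off w≢v)) (<-≤-trans
        (s≤s (+-monoˡ-≤ _ (raise≤2 (lab u)))) (≤-trans (3*-< lt) (m≤n+m _ (raise (lab w))))))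
      (incr (otherwise Ku u≢v) (otherwise Kw w≢v) a (trans (sym (≔-off ψ u≢v)) (trans e (≔-off ψ w≢v))))

  -- If `v` is saturated, no colour repeats on one side, so the equally coloured `x` and `y` are on
  -- opposite sides and are the only neighbours of their colour there.
  colour-root : ∀ {lab φ K v s x y D E} (C : Colouring lab φ K) → let open Colouring C in
    Decidable K → deg G v ≤ 2 * m → lab v ≡ inj₂ s →
    D ≢ E → lab x ≡ inj₁ D → lab y ≡ inj₁ E → Adj G v x → Adj G v y →
    ψ x ≡ ψ y → height x ≡ height y →
    Colouring lab φ (λ u → u ≡ v ⊎ K u)
  colour-root {lab} {φ} {K} {v} {x = x} {y} C K? deg≤ v-undone D≢E x∈D y∈E v~x v~y ψxy hxy
    with free-colour? G (Colouring.ψ C) K? v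
  ... | inj₁ (c , free) = colour-free C v-undone free
  ... | inj₂ sat = by-direction v~x v~y
    where
    open Colouring C

    in-unique : ∀ {u u′} → Arc G u v → Arc G u′ v → ψ u ≡ ψ u′ → u ≡ u′
    in-unique = saturated-in-unique G deg≤ sat

    out-unique : ∀ {u u′} → Arc G v u → Arc G v u′ → ψ u ≡ ψ u′ → u ≡ u′
    out-unique = saturated-out-unique G deg≤ sat

    by-direction : Adj G v x → Adj G v y → Colouring lab φ (λ u → u ≡ v ⊎ K u)
    by-direction (inj₁ a) (inj₁ b) = contradiction
      (inj₁-injective (trans (sym x∈D) (trans (cong lab (out-unique a b ψxy)) y∈E))) D≢E
    by-direction (inj₂ a) (inj₂ b) = contradiction
      (inj₁-injective (trans (sym x∈D) (trans (cong lab (in-unique a b ψxy)) y∈E))) D≢E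
    by-direction (inj₁ a) (inj₂ b) = colour-between C v-undone D≢E x∈D y∈E b a ψxy hxy
      (λ _ a′ e → in-unique a′ b e) (λ _ a′ e → out-unique a′ a e)
    by-direction (inj₂ a) (inj₁ b) = colour-between C v-undone (D≢E ∘ sym) y∈E x∈D a b
      (sym ψxy) (sym hxy) (λ _ a′ e → in-unique a′ a e) (λ _ a′ e → out-unique a′ b e)

-- Colouring the parts one by one

Unique-resp-↭ : ∀ {A : Set} {L L′ : List A} → L ↭ L′ → Unique L → Unique L′
Unique-resp-↭ {A} perm = Data.List.Relation.Binary.Permutation.Setoid.Properties.Unique-resp-↭
  (setoid A) (↭⇒↭ₛ perm)

module _ {Q p : ℕ} where

  -- The vertices to be coloured at one stage of the recursion. A part leaves `F` before the
  -- recursive call and is coloured after it.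
  data Live (F : Subset p) : Fin Q ⊎ Fin p → Set where
    done    : ∀ {d} → Live F (inj₁ d)
    pending : ∀ {s} → s ∈ F → Live F (inj₂ s)

  live? : ∀ F → Decidable (Live F)
  live? F (inj₁ d) = yes done
  live? F (inj₂ s) = map′ pending (λ { (pending s∈) → s∈ }) (s ∈? F)

module _ (G : Digraph) {Q p : ℕ} where
  open Digraph G

  Sees : Labelling G Q p → Fin p → Fin Q → Set
  Sees lab s b = ∃ λ u → ∃ λ w → lab u ≡ inj₂ s × lab w ≡ inj₁ b × Adj G u w

  -- The invariant of the recursion: no arc joins two blocks or two parts, and on `F` the sets `N`
  -- record exactly which blocks each part touches.
  record State (m : ℕ) (lab : Labelling G Q p) (F : Subset p) (N : Fin p → Subset Q) : Set where
    field
      done-arc    : ∀ {u v d e} → Adj G u v → lab u ≡ inj₁ d → lab v ≡ inj₁ e → d ≡ e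
      pending-arc : ∀ {u v s t} → Adj G u v → lab u ≡ inj₂ s → lab v ≡ inj₂ t → s ≡ t
      degree≤     : ∀ {u s} → lab u ≡ inj₂ s → deg G u ≤ 2 * m
      sees        : ∀ {s b} → s ∈ F → b ∈ N s → Sees lab s b
      seen        : ∀ {s b} → s ∈ F → Sees lab s b → b ∈ N s

  record Peeling (lab : Labelling G Q p) (s : Fin p) (L : List (Fin n)) (r : Fin n) : Set where
    field
      peels   : PeelsTo G L r
      unique  : Unique (L ∷ʳ r)
      within  : ∀ {u} → u List.∈ L ∷ʳ r → lab u ≡ inj₂ s
      covers  : ∀ {u} → lab u ≡ inj₂ s → u List.∈ L ∷ʳ r

  Peelable : Labelling G Q p → Fin p → Set
  Peelable lab s = ∃ λ L → ∃ λ r → Peeling lab s L r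

  peeling-to : ∀ {lab s L r v} → Peeling lab s L r → lab v ≡ inj₂ s → ∃ λ L′ → Peeling lab s L′ v
  peeling-to P v∈s with reroot G (Peeling.peels P) (Peeling.covers P v∈s)
  ... | L′ , peels′ , perm = L′ , record
    { peels  = peels′
    ; unique = Unique-resp-↭ (↭-sym perm) (Peeling.unique P)
    ; within = Peeling.within P ∘ ∈-resp-↭ perm
    ; covers = ∈-resp-↭ (↭-sym perm) ∘ Peeling.covers P
    }

  record SeesTwo (lab : Labelling G Q p) (z : Fin n) : Set where
    constructor sees-two
    field
      {x y} : Fin n
      {D E} : Fin Q
      D≢E   : D ≢ E
      x∈D   : lab x ≡ inj₁ D
      y∈E   : lab y ≡ inj₁ E
      z~x   : Adj G z x
      z~y   : Adj G z y

  sees-two? : ∀ {m lab F N z s} → State m lab F N → s ∈ F → lab z ≡ inj₂ s → Nonempty (N s) →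
    SeesTwo lab z ⊎ ∃ λ D → D ∈ N s × (∀ {u d} → Adj G z u → lab u ≡ inj₁ d → d ≡ D)
  sees-two? {lab = lab} {z = z} S s∈F z∈s (D₀ , D₀∈) with any? (λ x → adj? G z x ×-dec done? G lab x)
  -- A vertex without neighbours in blocks may join any block; one seen by the part is chosen, so
  -- that `N` can stay as it is.
  ... | no none = inj₂ (D₀ , D₀∈ , λ z~u u∈d → contradiction (_ , z~u , _ , u∈d) none)
  ... | yes (x , z~x , D , x∈D)
    with any? (λ y → any? λ E → adj? G z y ×-dec (≡-dec _≟_ _≟_ (lab y) (inj₁ E) ×-dec ¬? (D ≟ E)))
  ... | yes (y , E , z~y , y∈E , D≢E) = inj₁ (sees-two D≢E x∈D y∈E z~x z~y)
  ... | no none = inj₂ (D , State.seen S s∈F (z , x , z∈s , x∈D , z~x) , λ {u} {d} z~u u∈d →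
          decidable-stable (d ≟ D) λ d≢D → none (u , d , z~u , u∈d , d≢D ∘ sym))

  -- Absorbing a vertex into a block

  module _ {lab : Labelling G Q p} {z : Fin n} {s : Fin p} {D : Fin Q} (z∈s : lab z ≡ inj₂ s) where
    private
      lab′ : Labelling G Q p
      lab′ = lab [ z ≔ inj₁ D ]

    absorbed : lab′ z ≡ inj₁ D
    absorbed = ≔-at lab z

    absorb-pending⁻ : ∀ {u t} → lab′ u ≡ inj₂ t → u ≢ z × lab u ≡ inj₂ t
    absorb-pending⁻ {u} u∈t with u ≟ z
    ... | yes refl = contradiction u∈t (inj₁≢inj₂ absorbed)
    ... | no u≢z   = u≢z , trans (sym (≔-off lab u≢z)) u∈t

    absorb-pending⁺ : ∀ {u t} → u ≢ z → lab u ≡ inj₂ t → lab′ u ≡ inj₂ t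
    absorb-pending⁺ u≢z u∈t = trans (≔-off lab u≢z) u∈t

    absorb-done⁻ : ∀ {u d} → lab′ u ≡ inj₁ d → (u ≡ z × d ≡ D) ⊎ (u ≢ z × lab u ≡ inj₁ d)
    absorb-done⁻ {u} u∈d with u ≟ z
    ... | yes refl = inj₁ (refl , inj₁-injective (trans (sym u∈d) absorbed))
    ... | no u≢z   = inj₂ (u≢z , trans (sym (≔-off lab u≢z)) u∈d)

    absorb-done⁺ : ∀ {u d} → lab u ≡ inj₁ d → lab′ u ≡ inj₁ d
    absorb-done⁺ {u} u∈d with u ≟ z
    ... | yes refl = contradiction z∈s (inj₁≢inj₂ u∈d)
    ... | no u≢z   = trans (≔-off lab u≢z) u∈d

    -- As `z` sees no block but `D`, its move creates no arc between blocks. The part still sees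
    -- `D`: its remaining vertex `w` is adjacent to `z`. Nothing new is seen, since `D` was in
    -- `N s`.
    absorb-state : ∀ {m F N w} → State m lab F N → D ∈ N s →
      (∀ {u d} → Adj G z u → lab u ≡ inj₁ d → d ≡ D) →
      Adj G z w → w ≢ z → lab w ≡ inj₂ s → State m lab′ F N
    absorb-state {m} {F} {N} {w} S D∈ z-sees z~w w≢z w∈s = record
      { done-arc = done-arc′
      ; pending-arc = λ u~v u∈s v∈t →
          pending-arc u~v (proj₂ (absorb-pending⁻ u∈s)) (proj₂ (absorb-pending⁻ v∈t))
      ; degree≤ = λ u∈s → degree≤ (proj₂ (absorb-pending⁻ u∈s))
      ; sees = sees′
      ; seen = seen′
      }
      where
      open State S

      done-arc′ : ∀ {u v d e} → Adj G u v → lab′ u ≡ inj₁ d → lab′ v ≡ inj₁ e → d ≡ e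
      done-arc′ u~v u∈d v∈e with absorb-done⁻ u∈d | absorb-done⁻ v∈e
      ... | inj₁ (refl , refl) | inj₁ (refl , refl) = refl
      ... | inj₁ (refl , refl) | inj₂ (_ , v∈e₀) = sym (z-sees u~v v∈e₀)
      ... | inj₂ (_ , u∈d₀) | inj₁ (refl , refl) = z-sees (Sum.swap u~v) u∈d₀
      ... | inj₂ (_ , u∈d₀) | inj₂ (_ , v∈e₀) = done-arc u~v u∈d₀ v∈e₀

      sees′ : ∀ {t b} → t ∈ F → b ∈ N t → Sees lab′ t b
      sees′ t∈F b∈ with sees t∈F b∈
      ... | u , v , u∈t , v∈b , u~v with u ≟ z
      ... | no u≢z = u , v , absorb-pending⁺ u≢z u∈t , absorb-done⁺ v∈b , u~v
      ... | yes refl with refl ← inj₂-injective (trans (sym z∈s) u∈t) | refl ← z-sees u~v v∈b =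
            w , z , absorb-pending⁺ w≢z w∈s , absorbed , Sum.swap z~w

      seen′ : ∀ {t b} → t ∈ F → Sees lab′ t b → b ∈ N t
      seen′ t∈F (u , v , u∈t , v∈b , u~v) with absorb-pending⁻ u∈t | absorb-done⁻ v∈b
      ... | u≢z , u∈t₀ | inj₂ (_ , v∈b₀) = seen t∈F (u , v , u∈t₀ , v∈b₀ , u~v)
      ... | u≢z , u∈t₀ | inj₁ (refl , refl) with refl ← pending-arc u~v u∈t₀ z∈s = D∈

    absorb-peeling : ∀ {t L r} → t ≢ s → Peeling lab t L r → Peeling lab′ t L r
    absorb-peeling t≢s P = record
      { peels  = Peeling.peels P
      ; unique = Peeling.unique P
      ; within = λ u∈ → absorb-pending⁺ (λ { refl → t≢s (inj₂-injective
          (trans (sym (Peeling.within P u∈)) z∈s)) }) (Peeling.within P u∈)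
      ; covers = λ u∈t → Peeling.covers P (proj₂ (absorb-pending⁻ u∈t))
      }

    absorb-live : ∀ {F u} → Live F (lab u) → Live F (lab′ u)
    absorb-live {F} {u} live with u ≟ z
    ... | yes refl = subst (Live F) (sym absorbed) done
    ... | no u≢z   = subst (Live F) (sym (≔-off lab u≢z)) live

    -- z is a source or a sink of its colour class within the block, so it can be moved
    -- just below or just above the level of the block.
    unabsorb : ∀ {m F φ} {c : Fin m} → NoIn G φ (Done G lab) z c ⊎ NoOut G φ (Done G lab) z c →
      Colouring G lab′ (φ [ z ≔ c ]) (Live F ∘ lab′) → Colouring G lab φ (Live F ∘ lab)
    unabsorb {m} {F} {φ} {c} free C = record
      { ψ = ψ
      ; height = h free
      ; mono⁺ = λ same e → mono⁺ (same⁺ same) (trans (≔-off φ (≢z (done-left same)))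
          (trans e (sym (≔-off φ (≢z (done-right same))))))
      ; mono⁻ = λ same e → trans (sym (≔-off φ (≢z (done-left same))))
          (trans (mono⁻ (same⁺ same) e) (≔-off φ (≢z (done-right same))))
      ; level = λ same → trans (h-off free (≢z (done-left same)))
          (trans (cong (λ k → suc (3 * k)) (level (same⁺ same))) (sym (h-off free (≢z (done-right same)))))
      ; incr = h-incr
      }
      where
      open Colouring C

      done-left : ∀ {u v} → Same G lab u v → Done G lab u
      done-left (d , u∈d , _) = d , u∈d

      done-right : ∀ {u v} → Same G lab u v → Done G lab v
      done-right (d , _ , v∈d) = d , v∈d

      ≢z : ∀ {u} → Done G lab u → u ≢ z
      ≢z (d , u∈d) refl = inj₁≢inj₂ u∈d z∈s

      same⁺ : ∀ {u v} → Same G lab u v → Same G lab′ u v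
      same⁺ (d , u∈d , v∈d) = d , absorb-done⁺ u∈d , absorb-done⁺ v∈d

      -- The added `1` leaves a free level below the block for a source and one above it for a sink.
      base : Fin n → ℕ
      base u = suc (3 * height u)

      h : NoIn G φ (Done G lab) z c ⊎ NoOut G φ (Done G lab) z c → Fin n → ℕ
      h (inj₁ _) = base [ z ≔ 3 * height z ]
      h (inj₂ _) = base [ z ≔ 2 + 3 * height z ]

      h-off : ∀ f {u} → u ≢ z → h f u ≡ base u
      h-off (inj₁ _) = ≔-off base
      h-off (inj₂ _) = ≔-off base

      h-lower : ∀ f u → 3 * height u ≤ h f u
      h-lower f u with u ≟ z
      h-lower f u | no u≢z = subst (3 * height u ≤_) (sym (h-off f u≢z)) (n≤1+n _)
      h-lower (inj₁ _) u | yes refl = ≤-reflexive (sym (≔-at base z))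
      h-lower (inj₂ _) u | yes refl = subst (3 * height z ≤_) (sym (≔-at base z)) (m≤n+m _ 2)

      h-upper : ∀ f u → h f u ≤ 2 + 3 * height u
      h-upper f u with u ≟ z
      h-upper f u | no u≢z = subst (_≤ 2 + 3 * height u) (sym (h-off f u≢z)) (n≤1+n _)
      h-upper (inj₁ _) u | yes refl = subst (_≤ 2 + 3 * height z) (sym (≔-at base z)) (m≤n+m _ 2)
      h-upper (inj₂ _) u | yes refl = ≤-reflexive (≔-at base z)

      h-out : ∀ f {v} → v ≢ z → Arc G z v → Done G lab v → Same G lab′ z v → ψ z ≡ ψ v → h f z < h f v
      h-out (inj₁ _) v≢z a _ same e = subst₂ _<_ (sym (≔-at base z)) (sym (≔-off base v≢z))
        (s≤s (≤-reflexive (cong (3 *_) (level same))))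
      h-out (inj₂ no-out) v≢z a v-done same e = contradiction
        (trans (sym (≔-off φ v≢z)) (trans (sym (mono⁻ same e)) (≔-at φ z))) (no-out v-done a)

      h-in : ∀ f {u} → u ≢ z → Arc G u z → Done G lab u → Same G lab′ u z → ψ u ≡ ψ z → h f u < h f z
      h-in (inj₁ no-in) u≢z a u-done same e = contradiction
        (trans (sym (≔-off φ u≢z)) (trans (mono⁻ same e) (≔-at φ z))) (no-in u-done a)
      h-in (inj₂ _) u≢z a _ same e = subst₂ _<_ (sym (≔-off base u≢z)) (sym (≔-at base z))
        (s≤s (s≤s (≤-reflexive (cong (3 *_) (level same)))))

      h-incr : ∀ {u v} → Live F (lab u) → Live F (lab v) → Arc G u v → ψ u ≡ ψ v →
        Same G lab u v ⊎ h free u < h free v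
      h-incr {u} {v} Ku Kv a e with incr (absorb-live Ku) (absorb-live Kv) a e
      ... | inj₂ lt = inj₂ (<-≤-trans (s≤s (h-upper free u)) (≤-trans (3*-< lt) (h-lower free v)))
      ... | inj₁ same@(d , u∈d , v∈d) with absorb-done⁻ u∈d | absorb-done⁻ v∈d
      ... | inj₁ (refl , _) | inj₁ (refl , _) = contradiction a (no-loop G)
      ... | inj₁ (refl , _) | inj₂ (v≢z , v∈d₀) = inj₂ (h-out free v≢z a (d , v∈d₀) same e)
      ... | inj₂ (u≢z , u∈d₀) | inj₁ (refl , _) = inj₂ (h-in free u≢z a (d , u∈d₀) same e)
      ... | inj₂ (_ , u∈d₀) | inj₂ (_ , v∈d₀) = inj₁ (d , u∈d₀ , v∈d₀)

  -- Gluing two blocks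

  merge-pending⁻ : ∀ D E (lab : Labelling G Q p) {u t} → merge-labels G D E lab u ≡ inj₂ t → lab u ≡ inj₂ t
  merge-pending⁻ D E lab {u} = map₁-inj₂⁻ (identify D E) (lab u)

  merge-pending⁺ : ∀ D E (lab : Labelling G Q p) {u t} → lab u ≡ inj₂ t → merge-labels G D E lab u ≡ inj₂ t
  merge-pending⁺ D E lab = cong (Sum.map₁ (identify D E))

  merge-state : ∀ {m lab F N} D E s → State m lab F N →
    State m (merge-labels G D E lab) (F - s) (λ t → image (identify D E) (N t))
  merge-state {m} {lab} {F} {N} D E s S = record
    { done-arc = done-arc′
    ; pending-arc = λ u~v u∈s v∈t →
        pending-arc u~v (merge-pending⁻ D E lab u∈s) (merge-pending⁻ D E lab v∈t)
    ; degree≤ = λ u∈s → degree≤ (merge-pending⁻ D E lab u∈s)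
    ; sees = sees′
    ; seen = seen′
    }
    where
    open State S
    ρ : Fin Q → Fin Q
    ρ = identify D E

    lab′ : Labelling G Q p
    lab′ = merge-labels G D E lab

    done-arc′ : ∀ {u v d e} → Adj G u v → lab′ u ≡ inj₁ d → lab′ v ≡ inj₁ e → d ≡ e
    done-arc′ {u} {v} u~v u∈d v∈e with map₁-inj₁⁻ ρ (lab u) u∈d | map₁-inj₁⁻ ρ (lab v) v∈e
    ... | a , u∈a , refl | b , v∈b , refl = cong ρ (done-arc u~v u∈a v∈b)

    sees′ : ∀ {t b} → t ∈ F - s → b ∈ image ρ (N t) → Sees lab′ t b
    sees′ t∈ b∈ with ∈-image⁻ ρ b∈
    ... | a , a∈ , refl with sees (p─q⊆p F ⁅ s ⁆ t∈) a∈
    ... | u , v , u∈t , v∈a , u~v = u , v , cong (Sum.map₁ ρ) u∈t , cong (Sum.map₁ ρ) v∈a , u~v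

    seen′ : ∀ {t b} → t ∈ F - s → Sees lab′ t b → b ∈ image ρ (N t)
    seen′ t∈ (u , v , u∈t , v∈b , u~v) with map₁-inj₁⁻ ρ (lab v) v∈b
    ... | a , v∈a , refl = ∈-image⁺ ρ
      (seen (p─q⊆p F ⁅ s ⁆ t∈) (u , v , merge-pending⁻ D E lab u∈t , v∈a , u~v))

  merge-peeling : ∀ D E {lab t L r} → Peeling lab t L r → Peeling (merge-labels G D E lab) t L r
  merge-peeling D E {lab} P = record
    { Peeling P
    ; within = merge-pending⁺ D E lab ∘ Peeling.within P
    ; covers = Peeling.covers P ∘ merge-pending⁻ D E lab
    }

  merge-live : ∀ {F} D E (lab : Labelling G Q p) {u} → Live F (lab u) → Live F (merge-labels G D E lab u)
  merge-live {F} D E lab {u} live = from (lab u) live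
    where
    from : ∀ l → Live F l → Live F (Sum.map₁ (identify D E) l)
    from _ done         = done
    from _ (pending s∈) = pending s∈

  -- The induction step: colouring one part

  module _ {m : ℕ} {F : Subset p} {N : Fin p → Subset Q} {s : Fin p} (s∈F : s ∈ F)
    (mergeable : ∀ {D E} → D ∈ N s → E ∈ N s → D ≢ E →
      Hall (λ t → image (identify D E) (N t)) (F - s))
    (induction : ∀ {lab φ N′} → State m lab (F - s) N′ →
      (∀ {t} → t ∈ F - s → Peelable lab t) → Hall N′ (F - s) →
      Colouring G {m} lab φ (Live (F - s) ∘ lab)) where

    -- The order matters: glue `D` and `E` after the exchange of colours, colour the other parts by
    -- induction, colour `L` greedily, and only then separate the blocks and colour `v`, whose
    -- neighbours `x` and `y` now agree.
    colour-from-root : ∀ {lab φ L v} → State m lab F N → (∀ {t} → t ∈ F - s → Peelable lab t) →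
      Peeling lab s L v → SeesTwo lab v → Colouring G {m} lab φ (Live F ∘ lab)
    colour-from-root {lab} {φ} {L} {v} S peelable P (sees-two {x} {y} {D} {E} D≢E x∈D y∈E v~x v~y) =
      weaken G cover (colour-root G (proj₁ split) (λ u → (u ListDec.∈? L) ⊎-dec live? (F - s) (lab′ u))
        (State.degree≤ S v∈s) v∈s D≢E x∈D y∈E v~x v~y (proj₁ (proj₂ split)) (proj₂ (proj₂ split)))
      where
      module ListDec = Data.List.Membership.DecPropositional (_≟_ {n})

      lab′ : Labelling G Q p
      lab′ = merge-labels G D E lab

      v∈s : lab v ≡ inj₂ s
      v∈s = Peeling.within P (++⁺ʳ L (here refl))

      merged : Colouring G lab′ (λ u → shift G E (φ y) (φ x) (lab u) (φ u)) (Live (F - s) ∘ lab′)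
      merged = induction (merge-state D E s S)
        (λ t∈ → let (L′ , r , P′) = peelable t∈ in L′ , r , merge-peeling D E P′)
        (mergeable (State.seen S s∈F (v , x , v∈s , x∈D , v~x))
                   (State.seen S s∈F (v , y , v∈s , y∈E , v~y)) D≢E)

      not-live : ∀ {u} → lab′ u ≡ inj₂ s → ¬ Live (F - s) (lab′ u)
      not-live u∈s live with subst (Live (F - s)) u∈s live
      ... | pending s∈ = x∉p-x s F s∈

      along : Colouring G lab′ (λ u → shift G E (φ y) (φ x) (lab u) (φ u))
                (λ u → u List.∈ L ⊎ Live (F - s) (lab′ u))
      along = colour-along G (Peeling.peels P) (Peeling.unique P) (λ u → live? (F - s) (lab′ u))
        (λ u∈ → let u∈s = merge-pending⁺ D E lab (Peeling.within P u∈) in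
          not-live u∈s , (s , u∈s) , State.degree≤ S (Peeling.within P u∈))
        merged

      split : Σ (Colouring G lab φ (λ u → u List.∈ L ⊎ Live (F - s) (lab′ u))) λ C →
        Colouring.ψ C x ≡ Colouring.ψ C y × Colouring.height C x ≡ Colouring.height C y
      split = split-blocks G D≢E x∈D y∈E (State.done-arc S) along

      cover : ∀ {u} → Live F (lab u) → u ≡ v ⊎ (u List.∈ L ⊎ Live (F - s) (lab′ u))
      cover {u} live with ≡-dec _≟_ _≟_ (lab u) (inj₂ s)
      ... | yes u∈s = Sum.swap (Sum.map₁ inj₁ (∈-∷ʳ⁻ L (Peeling.covers P u∈s)))
      ... | no  u∉s = inj₂ (inj₂ (merge-live D E lab (from (lab u) u∉s live)))
        where
        from : ∀ l → l ≢ inj₂ s → Live F l → Live (F - s) l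
        from _ l≢ done          = done
        from _ l≢ (pending t∈F) = pending (x∈p∧x≢y⇒x∈p-y t∈F (l≢ ∘ cong inj₂))

    -- Induction on the peeling: its first vertex either sees two blocks and becomes the root, or
    -- joins a block and leaves a shorter peeling of the same part.
    colour-component : ∀ {L r lab φ} → State m lab F N → (∀ {t} → t ∈ F - s → Peelable lab t) →
      2 ≤ ∣ N s ∣ → Peeling lab s L r → Colouring G {m} lab φ (Live F ∘ lab)
    -- A single vertex is the whole part, so it sees all of `N s` and thus two blocks.
    colour-component {[]} {r} {lab} S peelable 2≤N P
      with (D , E , D∈ , E∈ , D≢E) ← 2≤∣p∣⇒distinct 2≤N
      with (u , x , u∈s , x∈D , u~x) ← State.sees S s∈F D∈
         | (v , y , v∈s , y∈E , v~y) ← State.sees S s∈F E∈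
      with here refl ← Peeling.covers P u∈s | here refl ← Peeling.covers P v∈s
      = colour-from-root S peelable P (sees-two D≢E x∈D y∈E u~x v~y)
    colour-component {z ∷ L} {r} {lab} {φ} S peelable 2≤N P
      with z∈s ← Peeling.within P (here refl)
      with sees-two? S s∈F z∈s (0<∣p∣⇒nonempty (<-trans z<s 2≤N))
    ... | inj₁ two = colour-from-root S peelable (proj₂ (peeling-to P z∈s)) two
    ... | inj₂ (D , D∈ , z-sees)
      with peel {w = w} z~w w∈ peels′ ← Peeling.peels P | z∉ ∷ unique′ ← Peeling.unique P
      with w∈s ← Peeling.within P (there w∈)
      -- The colour is chosen in `φ`, before the recursion, so that `z` follows every later
      -- permutation of the block `D`. The pending neighbour `w` makes a free colour available.
      with c , free ← free-colour G φ (done? G lab) (State.degree≤ S z∈s) z~w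
             (λ (d , w∈d) → inj₁≢inj₂ w∈d w∈s)
      = unabsorb z∈s free (colour-component
          (absorb-state z∈s S D∈ z-sees z~w (λ { refl → All.lookup z∉ w∈ refl }) w∈s)
          (λ t∈ → let (L′ , r′ , P′) = peelable t∈ in
            L′ , r′ , absorb-peeling z∈s (∈-⇒≢ {p = F} t∈) P′)
          2≤N
          (record
            { peels  = peels′
            ; unique = unique′
            ; within = λ u∈ → absorb-pending⁺ z∈s (λ { refl → All.lookup z∉ u∈ refl })
                (Peeling.within P (there u∈))
            ; covers = λ u∈s → let (u≢z , u∈s₀) = absorb-pending⁻ z∈s u∈s in
                tail-member u≢z (Peeling.covers P u∈s₀)
            }))
      where
      tail-member : ∀ {u} → u ≢ z → u List.∈ z ∷ (L ∷ʳ r) → u List.∈ L ∷ʳ r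
      tail-member u≢z (here e)   = contradiction e u≢z
      tail-member u≢z (there u∈) = u∈

  -- Induction on the size of `F`. When `F` is empty, all live vertices lie in blocks and no arc
  -- joins two blocks, so `φ` with constant height suffices.
  colour-components : ∀ {m} k {F lab φ N} → ∣ F ∣ ≤ k → State m lab F N →
    (∀ {s} → s ∈ F → Peelable lab s) → Hall N F → Colouring G {m} lab φ (Live F ∘ lab)
  colour-components k {F} {lab} {φ} F≤k S peelable hall with nonempty? F
  ... | no empty = record
    { ψ = φ ; height = λ _ → 0 ; mono⁺ = λ _ e → e ; mono⁻ = λ _ e → e ; level = λ _ → refl
    ; incr = λ {u} {v} Ku Kv a _ → inj₁ (both-done (lab u) (lab v) Ku Kv (State.done-arc S (inj₁ a))) }
    where
    both-done : ∀ l l′ → Live F l → Live F l′ → (∀ {d e} → l ≡ inj₁ d → l′ ≡ inj₁ e → d ≡ e) →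
      ∃ λ d → l ≡ inj₁ d × l′ ≡ inj₁ d
    both-done _ _ (pending s∈) _ _ = contradiction (_ , s∈) empty
    both-done _ _ _ (pending s∈) _ = contradiction (_ , s∈) empty
    both-done _ _ done done d≡e = _ , refl , cong inj₁ (sym (d≡e refl refl))
  colour-components zero F≤k S peelable hall | yes (s , s∈F) =
    contradiction (<-≤-trans (≤-<-trans z≤n (x∈p⇒∣p-x∣<∣p∣ s∈F)) F≤k) λ ()
  colour-components (suc k) {F} {N = N} F≤k S peelable hall | yes ne
    with (s , s∈F , mergeable) ← exists-mergeable N F hall ne
    with (L , r , P) ← peelable s∈F
    = colour-component s∈F mergeable
        (colour-components k (s≤s⁻¹ (<-≤-trans (x∈p⇒∣p-x∣<∣p∣ s∈F) F≤k)))
        S (λ t∈ → peelable (p─q⊆p F ⁅ s ⁆ t∈)) (Hall⇒2≤ N hall s∈F) P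

-- Components

lookup-injective : ∀ {A : Set} {L : List A} → Unique L → ∀ i j → lookup L i ≡ lookup L j → i ≡ j
lookup-injective {L = _ ∷ _} (_ ∷ _)    zero    zero    _ = refl
lookup-injective {L = _ ∷ L} (x∉ ∷ _)   zero    (suc j) e = contradiction e (All.lookup x∉ (∈-lookup j))
lookup-injective {L = _ ∷ L} (x∉ ∷ _)   (suc i) zero    e = contradiction (sym e) (All.lookup x∉ (∈-lookup i))
lookup-injective {L = _ ∷ _} (_ ∷ uniq) (suc i) (suc j) e = cong suc (lookup-injective uniq i j e)

suc-embedding⇒∣p∣≤∣q∣ : ∀ {n} {A : Subset n} {B : Subset (suc n)} →
                        (∀ {a} → a ∈ A → suc a ∈ B) → ∣ A ∣ ≤ ∣ B ∣
suc-embedding⇒∣p∣≤∣q∣ {A = A} {b ∷ B} A⊆B =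
  ≤-trans (p⊆q⇒∣p∣≤∣q∣ (λ a∈ → drop-there (A⊆B a∈))) (∣p∣≤∣x∷p∣ b B)

∈-class⁺ : ∀ {n m} (c : Fin n → Fin m) {i v} → c v ≡ i → v ∈ tabulate (λ u → ⌊ c u ≟ i ⌋)
∈-class⁺ c {i} {v} e = lookup⇒[]= v _ (trans (lookup∘tabulate _ v)
  (trans (isYes≗does (c v ≟ i)) (dec-true (c v ≟ i) e)))

∈-class⁻ : ∀ {n m} (c : Fin n → Fin m) {i v} → v ∈ tabulate (λ u → ⌊ c u ≟ i ⌋) → c v ≡ i
∈-class⁻ c {i} {v} v∈ with c v ≟ i | trans (sym (lookup∘tabulate (λ u → ⌊ c u ≟ i ⌋) v)) ([]=⇒lookup v∈)
... | yes e | _ = e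
... | no _  | ()

∈-all : ∀ {n} (v : Fin n) → v ∈ tabulate (λ _ → true)
∈-all v = lookup⇒[]= v _ (lookup∘tabulate _ v)

module _ (G : Digraph) where
  open Digraph G

  walk-mono : ∀ {T T′ u v} → T ⊆ T′ → Walk G T u v → Walk G T′ u v
  walk-mono T⊆ (step u∈ v∈ a)  = step (T⊆ u∈) (T⊆ v∈) a
  walk-mono T⊆ ((u∈ , a) ∷ w) = (T⊆ u∈ , a) ∷ walk-mono T⊆ w

  UAdj-sym : ∀ {T u v} → UAdj G T u v → UAdj G T v u
  UAdj-sym (u∈ , v∈ , u~v) = v∈ , u∈ , Sum.swap u~v

  UAdj-mono : ∀ {T T′ u v} → T ⊆ T′ → UAdj G T u v → UAdj G T′ u v
  UAdj-mono T⊆ (u∈ , v∈ , u~v) = T⊆ u∈ , T⊆ v∈ , u~v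

  rooted⇒connected : ∀ {T r} → (∀ {u} → u ∈ T → Star (UAdj G T) u r) → Connected G T
  rooted⇒connected to-root u v u∈ v∈ = to-root u∈ ◅◅ Star.reverse UAdj-sym (to-root v∈)

  peels⇒path : ∀ {T L r x} → PeelsTo G L r → (∀ {u} → u List.∈ L ∷ʳ r → u ∈ T) →
               x List.∈ L ∷ʳ r → Star (UAdj G T) x r
  peels⇒path []              L⊆T (here refl) = ε
  peels⇒path (peel z~w w∈ P) L⊆T (here refl) =
    (L⊆T (here refl) , L⊆T (there w∈) , z~w) ◅ peels⇒path P (L⊆T ∘ there) w∈
  peels⇒path (peel z~w w∈ P) L⊆T (there x∈)  = peels⇒path P (L⊆T ∘ there) x∈

  star-closed : ∀ {T} {P : Fin n → Set} → (∀ {u v} → P u → v ∈ T → Adj G u v → P v) →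
                ∀ {u v} → Star (UAdj G T) u v → P u → P v
  star-closed closed ε                        Pu = Pu
  star-closed closed ((_ , v∈ , u~v) ◅ path) Pu = star-closed closed path (closed Pu v∈ u~v)

  private
    module ListDec = Data.List.Membership.DecPropositional (_≟_ {n})

  component-of : ∀ Y {v} → v ∈ Y → ∃ λ C → Component G Y C × v ∈ C
  component-of Y {v} v∈Y with (L , P , _ , L⊆Y , closed) ← reachable-peeling G Y v∈Y =
    C , (L⊆Y ∘ C⇒L , rooted⇒connected (peels⇒path P L⇒C ∘ C⇒L) , maximal) , v∈C
    where
    member? : Decidable (List._∈ (L ∷ʳ v))
    member? x = x ListDec.∈? (L ∷ʳ v)

    C : Subset n
    C = ⟪ member? ⟫

    C⇒L : ∀ {x} → x ∈ C → x List.∈ L ∷ʳ v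
    C⇒L = ∈⟪⟫⁻ member?

    L⇒C : ∀ {x} → x List.∈ L ∷ʳ v → x ∈ C
    L⇒C = ∈⟪⟫⁺ member?

    v∈C : v ∈ C
    v∈C = L⇒C (++⁺ʳ L (here refl))

    maximal : ∀ S → C ⊆ S → S ⊆ Y → Connected G S → S ⊆ C
    maximal S C⊆S S⊆Y conn {x} x∈S = L⇒C (star-closed (λ u∈ w∈ u~w → closed u∈ (S⊆Y w∈) u~w)
      (conn v x (C⊆S v∈C) x∈S) (++⁺ʳ L (here refl)))

  connected-peeling : ∀ {C v} → Connected G C → v ∈ C → ∃ λ L → PeelsTo G L v × Unique (L ∷ʳ v) ×
    (∀ {x} → x List.∈ L ∷ʳ v → x ∈ C) × (∀ {x} → x ∈ C → x List.∈ L ∷ʳ v)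
  connected-peeling {C} {v} conn v∈C with (L , P , uniq , L⊆C , closed) ← reachable-peeling G C v∈C =
    L , P , uniq , L⊆C , λ {x} x∈C → star-closed closed (conn v x v∈C x∈C) (++⁺ʳ L (here refl))

  -- Adding `v` keeps the set connected through `u`, so maximality applies.
  component-closed : ∀ {Y C u v} → Component G Y C → u ∈ C → v ∈ Y → Adj G u v → v ∈ C
  component-closed {Y} {C} {u} {v} (C⊆Y , conn , maximal) u∈C v∈Y u~v =
    maximal (C ∪ ⁅ v ⁆) (p⊆p∪q ⁅ v ⁆) C∪v⊆Y (rooted⇒connected to-u) v∈C∪v
    where
    v∈C∪v : v ∈ C ∪ ⁅ v ⁆
    v∈C∪v = q⊆p∪q C ⁅ v ⁆ (x∈⁅x⁆ v)

    C∪v⊆Y : C ∪ ⁅ v ⁆ ⊆ Y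
    C∪v⊆Y x∈ with x∈p∪q⁻ C ⁅ v ⁆ x∈
    ... | inj₁ x∈C = C⊆Y x∈C
    ... | inj₂ x∈v with refl ← x∈⁅y⁆⇒x≡y v x∈v = v∈Y

    to-u : ∀ {x} → x ∈ C ∪ ⁅ v ⁆ → Star (UAdj G (C ∪ ⁅ v ⁆)) x u
    to-u x∈ with x∈p∪q⁻ C ⁅ v ⁆ x∈
    ... | inj₁ x∈C = Star.map (UAdj-mono (p⊆p∪q ⁅ v ⁆)) (conn _ u x∈C u∈C)
    ... | inj₂ x∈v with refl ← x∈⁅y⁆⇒x≡y v x∈v = (v∈C∪v , p⊆p∪q ⁅ v ⁆ u∈C , Sum.swap u~v) ◅ ε

  component-absorbs : ∀ {Y C C′ v} → Component G Y C → Component G Y C′ → v ∈ C → v ∈ C′ → C′ ⊆ C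
  component-absorbs {v = v} comp (C′⊆Y , conn , _) v∈C v∈C′ {x} x∈C′ =
    star-closed (λ u∈C w∈C′ u~w → component-closed comp u∈C (C′⊆Y w∈C′) u~w) (conn v x v∈C′ x∈C′) v∈C

  module _ {Y : Subset n} {L : List (Subset n)} (components : ComponentList G Y L) where

    component-at : ∀ i → Component G Y (lookup L i)
    component-at i = All.lookup (proj₁ (proj₂ components)) (∈-lookup i)

    component-index : ∀ {v} → v ∈ Y → ∃ λ i → v ∈ lookup L i
    component-index v∈Y with (C , comp , v∈C) ← component-of Y v∈Y =
      let C∈L = proj₂ (proj₂ components) C comp in
      index C∈L , subst (_ ∈_) (lookup-index C∈L) v∈C

    component-unique : ∀ {v i j} → v ∈ lookup L i → v ∈ lookup L j → i ≡ j
    component-unique {v} {i} {j} v∈i v∈j = lookup-injective (proj₁ components) i j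
      (⊆-antisym (component-absorbs (component-at j) (component-at i) v∈j v∈i)
                 (component-absorbs (component-at i) (component-at j) v∈i v∈j))

    component-arc : ∀ {u v i j} → Adj G u v → u ∈ lookup L i → v ∈ lookup L j → i ≡ j
    component-arc {i = i} {j} u~v u∈i v∈j = component-unique
      (component-closed (component-at i) u∈i (proj₁ (component-at j) v∈j) u~v) v∈j

    -- An empty component lies in every other one, which by maximality is then empty too; so it
    -- would be the only one.
    component-nonempty : 2 ≤ length L → ∀ i → Nonempty (lookup L i)
    component-nonempty 2≤ i with nonempty? (lookup L i)
    ... | yes ne = ne
    ... | no empty with (j , k , _ , _ , j≢k) ← 2≤∣p∣⇒distinct {p = ⊤} (subst (2 ≤_) (sym (∣⊤∣≡n (length L))) 2≤) =
      contradiction (trans (only j) (sym (only k))) j≢k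
      where
      nothing : ∀ {A : Subset n} → lookup L i ⊆ A
      nothing x∈ = contradiction (_ , x∈) empty

      only : ∀ j → j ≡ i
      only j = lookup-injective (proj₁ components) j i (⊆-antisym
        (proj₂ (proj₂ (component-at i)) (lookup L j) nothing
          (proj₁ (component-at j)) (proj₁ (proj₂ (component-at j))))
        nothing)

  -- Heights never decrease along a monochromatic walk, so a closed one stays in a block.
  colouring⇒dichromatic : ∀ {T m Q p} {lab : Labelling G Q p} {φ : Fin n → Fin m} {K} →
    Colouring G lab φ K → (∀ u → K u) → (∀ {u} → Done G lab u → u ∈ T) →
    (∀ i → Acyclic G (T ∩ tabulate (λ v → ⌊ φ v ≟ i ⌋))) → DichromaticGLE G m
  colouring⇒dichromatic {T} {m} {lab = lab} {φ} C all-K done∈T acyclic = ψ , λ i u walk →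
    case rises walk of λ
      { (inj₁ lt) → <-irrefl refl lt
      ; (inj₂ (_ , walk′)) → acyclic (φ u) u walk′ }
    where
    open Colouring C

    class : (Fin n → Fin m) → Fin m → Subset n
    class c i = tabulate (λ v → ⌊ c v ≟ i ⌋)

    monochromatic : ∀ {i u} → u ∈ tabulate (λ _ → true) ∩ class ψ i → ψ u ≡ i
    monochromatic {i} u∈ = ∈-class⁻ ψ (proj₂ (x∈p∩q⁻ (tabulate (λ _ → true)) (class ψ i) u∈))

    in-class : ∀ {u c} → Done G lab u → φ u ≡ c → u ∈ T ∩ class φ c
    in-class u-done e = x∈p∩q⁺ (done∈T u-done , ∈-class⁺ φ e)

    arc-rises : ∀ {i u v} → ψ u ≡ i → ψ v ≡ i → Arc G u v → Same G lab u v ⊎ height u < height v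
    arc-rises {u = u} {v} u∈i v∈i a = incr (all-K u) (all-K v) a (trans u∈i (sym v∈i))

    start : ∀ {i u v} → Walk G (tabulate (λ _ → true) ∩ class ψ i) u v → ψ u ≡ i
    start (step u∈ _ _)   = monochromatic u∈
    start ((u∈ , _) ∷ _) = monochromatic u∈

    rises : ∀ {i u v} → Walk G (tabulate (λ _ → true) ∩ class ψ i) u v →
      height u < height v ⊎ (Same G lab u v × Walk G (T ∩ class φ (φ u)) u v)
    rises (step u∈ v∈ a) with arc-rises (monochromatic u∈) (monochromatic v∈) a
    ... | inj₂ lt = inj₁ lt
    ... | inj₁ same@(d , u∈d , v∈d) = inj₂ (same , step (in-class (d , u∈d) refl)
          (in-class (d , v∈d) (sym (mono⁻ same (trans (monochromatic u∈) (sym (monochromatic v∈)))))) a)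
    rises (_∷_ {u} {w} {v} (u∈ , a) walk)
      with arc-rises (monochromatic u∈) (start walk) a | rises walk
    ... | inj₂ lt | inj₁ lt′ = inj₁ (<-trans lt lt′)
    ... | inj₂ lt | inj₂ (same , _) = inj₁ (subst (height u <_) (level same) lt)
    ... | inj₁ same | inj₁ lt′ = inj₁ (subst (_< height v) (sym (level same)) lt′)
    ... | inj₁ same@(d , u∈d , w∈d) | inj₂ ((e , w∈e , v∈e) , walk′) = inj₂
      ( (d , u∈d , trans v∈e (cong inj₁ (inj₁-injective (trans (sym w∈e) w∈d))))
      , (in-class (d , u∈d) refl , a) ∷ subst (λ c → Walk G (T ∩ class φ c) w v)
          (sym (mono⁻ same (trans (monochromatic u∈) (sym (start walk))))) walk′ )

  -- The initial blocks and parts, and the conclusion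

  module _ (connected : ConnectedDigraph G) {X : Subset n} {L₁ L₂ : List (Subset n)}
    (blocks : ComponentList G (∁ X) L₁) (parts : ComponentList G X L₂) where
    private
      q p : ℕ
      q = length L₁
      p = length L₂

      B : Fin q → Subset n
      B = lookup L₁

      S : Fin p → Subset n
      S = lookup L₂

      B⊆∁X : ∀ j → B j ⊆ ∁ X
      B⊆∁X j = proj₁ (component-at blocks j)

      S⊆X : ∀ s → S s ⊆ X
      S⊆X s = proj₁ (component-at parts s)

      touches? : ∀ s j → Dec (∃ λ u → ∃ λ w → u ∈ S s × w ∈ B j × Adj G u w)
      touches? s j = any? λ u → any? λ w → (u ∈? S s) ×-dec ((w ∈? B j) ×-dec adj? G u w)

      N : Fin p → Subset q
      N s = ⟪ touches? s ⟫

    -- A path from the block to `x₀` has to leave it, and the first vertex outside is in `X`,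
    -- because a component of `G - X` is closed under adjacency in the complement of `X`.
    adjacent-block : ∀ {x₀} → x₀ ∈ X → 2 ≤ q → ∀ j → ∃ λ s → j ∈ N s
    adjacent-block {x₀} x₀∈X 2≤q j
      with (w , w∈B) ← component-nonempty blocks 2≤q j
      = exit w∈B (connected w x₀ (∈-all w) (∈-all x₀))
      where
      exit : ∀ {u} → u ∈ B j → Star (UAdj G (tabulate (λ _ → true))) u x₀ → ∃ λ s → j ∈ N s
      exit u∈B ε = contradiction (B⊆∁X j u∈B) (x∈p⇒x∉∁p x₀∈X)
      exit {u} u∈B (_◅_ {j = v} (_ , _ , u~v) path) with v ∈? X
      ... | no v∉X = exit (component-closed (component-at blocks j) u∈B (x∉p⇒x∈∁p v∉X) u~v) path
      ... | yes v∈X with (s , v∈S) ← component-index parts v∈X =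
            s , ∈⟪⟫⁺ (touches? s) (v , u , v∈S , u∈B , Sum.swap u~v)

    all-blocks-adjacent : ∀ {x₀} → x₀ ∈ X → p < q → p < ∣ nbhd N ⊤ ∣
    all-blocks-adjacent {x₀} x₀∈X p<q = <-≤-trans p<q (begin
      q              ≡⟨ ∣⊤∣≡n q ⟨
      ∣ ⊤ {n = q} ∣  ≤⟨ p⊆q⇒∣p∣≤∣q∣ {p = ⊤} (λ {j} _ →
                          let (s , j∈) = adjacent-block x₀∈X 2≤q j in ∈-nbhd⁺ N ∈⊤ j∈) ⟩
      ∣ nbhd N ⊤ ∣   ∎)
      where
      open ≤-Reasoning
      2≤q : 2 ≤ q
      -- The vertex `x₀` lies in some part, so `p` is at least one.
      2≤q = ≤-trans (s≤s (≤-trans (s≤s z≤n) (toℕ<n (proj₁ (component-index parts x₀∈X))))) p<q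

    module _ {W : Subset p} {s₀ : Fin p} (s₀∉W : s₀ ∉ W)
      (surplus : ∀ U → U ⊆ ∁ W → Nonempty U → ∣ U ∣ < ∣ nbhd N U ─ nbhd N W ∣) where
      private
        NW : Subset q
        NW = nbhd N W

      -- Block zero is the union of the components indexed by W and of all the blocks they touch.
      data Labelled (v : Fin n) : Fin (suc q) ⊎ Fin p → Set where
        block     : ∀ {j} → v ∈ B j → j ∉ NW → Labelled v (inj₁ (suc j))
        hub-block : ∀ {j} → v ∈ B j → j ∈ NW → Labelled v (inj₁ zero)
        hub-part  : ∀ {s} → v ∈ S s → s ∈ W → Labelled v (inj₁ zero)
        part      : ∀ {s} → v ∈ S s → s ∉ W → Labelled v (inj₂ s)

      classify : ∀ v → ∃ (Labelled v)
      classify v with v ∈? X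
      ... | yes v∈X with (s , v∈S) ← component-index parts v∈X with s ∈? W
      ...   | yes s∈W = _ , hub-part v∈S s∈W
      ...   | no s∉W  = _ , part v∈S s∉W
      classify v | no v∉X with (j , v∈B) ← component-index blocks (x∉p⇒x∈∁p v∉X) with j ∈? NW
      ...   | yes j∈NW = _ , hub-block v∈B j∈NW
      ...   | no j∉NW  = _ , block v∈B j∉NW

      lab : Labelling G (suc q) p
      lab v = proj₁ (classify v)

      labelled : ∀ {v l} → lab v ≡ l → Labelled v l
      labelled {v} refl = proj₂ (classify v)

      B∩S : ∀ {v j s} → v ∈ B j → v ∉ S s
      B∩S {j = j} {s} v∈B v∈S = x∈∁p⇒x∉p (B⊆∁X j v∈B) (S⊆X s v∈S)

      label-part : ∀ {v s} → v ∈ S s → s ∉ W → lab v ≡ inj₂ s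
      label-part {v} v∈S s∉W with classify v
      ... | _ , block v∈B _     = contradiction v∈S (B∩S v∈B)
      ... | _ , hub-block v∈B _ = contradiction v∈S (B∩S v∈B)
      ... | _ , hub-part v∈S′ s∈W with refl ← component-unique parts v∈S v∈S′ = contradiction s∈W s∉W
      ... | _ , part v∈S′ _ = cong inj₂ (component-unique parts v∈S′ v∈S)

      label-block : ∀ {v j} → v ∈ B j → j ∉ NW → lab v ≡ inj₁ (suc j)
      label-block {v} v∈B j∉NW with classify v
      ... | _ , block v∈B′ _ = cong (inj₁ ∘ suc) (component-unique blocks v∈B′ v∈B)
      ... | _ , hub-block v∈B′ j∈NW with refl ← component-unique blocks v∈B v∈B′ = contradiction j∈NW j∉NW
      ... | _ , hub-part v∈S _ = contradiction v∈S (B∩S v∈B)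
      ... | _ , part v∈S _     = contradiction v∈S (B∩S v∈B)

      sees? : ∀ s → Decidable (Sees G lab s)
      sees? s b = any? λ u → any? λ w →
        ≡-dec _≟_ _≟_ (lab u) (inj₂ s) ×-dec (≡-dec _≟_ _≟_ (lab w) (inj₁ b) ×-dec adj? G u w)

      M : Fin p → Subset (suc q)
      M s = ⟪ sees? s ⟫

      -- The hypothesis `surplus` counts only blocks outside `NW`. These keep labels of their own,
      -- `suc j`, and the hub can only enlarge the neighbourhood.
      M-Hall : Hall M (∁ W)
      M-Hall U U⊆∁W ne = <-≤-trans (surplus U U⊆∁W ne) (suc-embedding⇒∣p∣≤∣q∣ embed)
        where
        embed : ∀ {j} → j ∈ nbhd N U ─ NW → suc j ∈ nbhd M U
        embed {j} j∈ with (s , s∈U , j∈Ns) ← ∈-nbhd⁻ N (p─q⊆p _ _ j∈)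
          with (u , w , u∈S , w∈B , u~w) ← ∈⟪⟫⁻ (touches? s) j∈Ns =
          ∈-nbhd⁺ M s∈U (∈⟪⟫⁺ (sees? s) (u , w , label-part u∈S (x∈∁p⇒x∉p (U⊆∁W s∈U)) ,
            label-block w∈B (x∈p─q⇒x∉q (nbhd N U) NW j∈) , u~w))

      in-hub : ∀ {u v j s} → v ∈ B j → u ∈ S s → s ∈ W → Adj G u v → j ∈ NW
      in-hub {u} {v} {s = s} v∈B u∈S s∈W u~v =
        ∈-nbhd⁺ N s∈W (∈⟪⟫⁺ (touches? s) (u , v , u∈S , v∈B , u~v))

      -- Every block touched by a part of `W` belongs to the hub, so no arc connects the hub with
      -- another block.
      labelled-done-arc : ∀ {u v d e} → Adj G u v → Labelled u (inj₁ d) → Labelled v (inj₁ e) → d ≡ e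
      labelled-done-arc u~v (block u∈ _) (block v∈ _) = cong suc (component-arc blocks u~v u∈ v∈)
      labelled-done-arc u~v (block u∈ ∉NW) (hub-block v∈ ∈NW)
        with refl ← component-arc blocks u~v u∈ v∈ = contradiction ∈NW ∉NW
      labelled-done-arc u~v (hub-block u∈ ∈NW) (block v∈ ∉NW)
        with refl ← component-arc blocks u~v u∈ v∈ = contradiction ∈NW ∉NW
      labelled-done-arc u~v (block u∈ ∉NW) (hub-part v∈ ∈W) =
        contradiction (in-hub u∈ v∈ ∈W (Sum.swap u~v)) ∉NW
      labelled-done-arc u~v (hub-part u∈ ∈W) (block v∈ ∉NW) = contradiction (in-hub v∈ u∈ ∈W u~v) ∉NW
      labelled-done-arc u~v (hub-block _ _) (hub-block _ _) = refl
      labelled-done-arc u~v (hub-block _ _) (hub-part _ _)  = refl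
      labelled-done-arc u~v (hub-part _ _)  (hub-block _ _) = refl
      labelled-done-arc u~v (hub-part _ _)  (hub-part _ _)  = refl

      labelled-pending-arc : ∀ {u v s t} → Adj G u v → Labelled u (inj₂ s) → Labelled v (inj₂ t) → s ≡ t
      labelled-pending-arc u~v (part u∈ _) (part v∈ _) = component-arc parts u~v u∈ v∈

      part⁻ : ∀ {v s} → lab v ≡ inj₂ s → v ∈ S s
      part⁻ v∈s with part v∈S _ ← labelled v∈s = v∈S

      initial-state : ∀ {m} → (∀ u → u ∈ X → deg G u ≤ 2 * m) → State G m lab (∁ W) M
      initial-state degree = record
        { done-arc    = λ u~v u∈d v∈e → labelled-done-arc u~v (labelled u∈d) (labelled v∈e)
        ; pending-arc = λ u~v u∈s v∈t → labelled-pending-arc u~v (labelled u∈s) (labelled v∈t)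
        ; degree≤     = λ {u} {s} u∈s → degree u (S⊆X s (part⁻ u∈s))
        ; sees        = λ {s} _ → ∈⟪⟫⁻ (sees? s)
        ; seen        = λ {s} _ → ∈⟪⟫⁺ (sees? s)
        }

      initial-peelable : ∀ {s} → s ∈ ∁ W → Peelable G lab s
      initial-peelable {s} s∈
        -- A block seen by the part supplies a vertex of the part at which the peeling can end.
        with (b , b∈) ← 0<∣p∣⇒nonempty (<-trans z<s (Hall⇒2≤ M M-Hall s∈))
        with (r , _ , r∈s , _) ← ∈⟪⟫⁻ (sees? s) b∈
        with (L , P , uniq , L⊆S , S⊆L) ←
               connected-peeling (proj₁ (proj₂ (component-at parts s))) (part⁻ r∈s)
        = L , r , record
          { peels = P ; unique = uniq
          ; within = λ u∈ → label-part (L⊆S u∈) (x∈∁p⇒x∉p s∈)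
          ; covers = λ u∈s → S⊆L (part⁻ u∈s)
          }

      all-live : ∀ u → Live (∁ W) (lab u)
      all-live u with classify u
      ... | _ , block _ _     = done
      ... | _ , hub-block _ _ = done
      ... | _ , hub-part _ _  = done
      ... | _ , part _ s∉W    = pending (x∉p⇒x∈∁p s∉W)

      -- Since `s₀` is outside `W`, no vertex of a block lies in `S s₀`. The colouring of `G - S s₀`
      -- is therefore acyclic on the blocks.
      extend-colouring : ∀ {m} → (∀ u → u ∈ X → deg G u ≤ 2 * m) →
        DichromaticLE G (∁ (S s₀)) m → DichromaticGLE G m
      extend-colouring degree (φ , acyclic) = colouring⇒dichromatic
        (colour-components G ∣ ∁ W ∣ ≤-refl (initial-state degree) initial-peelable M-Hall)
        all-live
        (λ (_ , u∈d) → x∉p⇒x∈∁p (λ u∈S → inj₁≢inj₂ u∈d (label-part u∈S s₀∉W)))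
        acyclic

    dicolourable : ∀ {m x₀} → x₀ ∈ X → p < q → (∀ u → u ∈ X → deg G u ≤ 2 * m) →
      (∀ C → Component G X C → DichromaticLE G (∁ C) m) → DichromaticGLE G m
    dicolourable {m} x₀∈X p<q degree colourable =
      finish (exists-deficient N (all-blocks-adjacent x₀∈X p<q))
      where
      finish : (∃ λ W → (∃ λ s → s ∉ W) ×
        (∀ U → U ⊆ ∁ W → Nonempty U → ∣ U ∣ < ∣ nbhd N U ─ nbhd N W ∣)) → DichromaticGLE G m
      finish (W , (s₀ , s₀∉W) , surplus) =
        extend-colouring s₀∉W surplus degree (colourable (S s₀) (component-at parts s₀))

  empty⇒component : ∀ {X} → Empty X → Component G X ⊥
  empty⇒component empty = (λ x∈ → contradiction x∈ ∉⊥) , (λ u v u∈ → contradiction u∈ ∉⊥) ,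
    λ S _ S⊆X _ x∈ → contradiction (_ , S⊆X x∈) empty

theorem6p1 : (G : Digraph) → ConnectedDigraph G → (k : ℕ) → 3 ≤ k →
    (X : Subset (Digraph.n G)) →
    (∀ u → u ∈ X → deg G u ≤ 2 * (k ∸ 1)) →
    (∀ S → Component G X S → DichromaticLE G (∁ S) (k ∸ 1)) →
    (Σ (List (Subset (Digraph.n G))) λ L₁ → Σ (List (Subset (Digraph.n G))) λ L₂ →
    ComponentList G (∁ X) L₁ × ComponentList G X L₂ × length L₂ < length L₁) →
    DichromaticGLE G (k ∸ 1)
theorem6p1 G connected k _ X degree colourable (L₁ , L₂ , blocks , parts , p<q) with nonempty? X
-- For empty `X` the empty set is a component of `G[X]`, and removing it leaves all of `G`.
... | no empty with (c , acyclic) ← colourable ⊥ (empty⇒component G empty) =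
  c , λ i u walk → acyclic i u (walk-mono G
    (λ x∈ → x∈p∩q⁺ (x∉p⇒x∈∁p ∉⊥ , proj₂ (x∈p∩q⁻ (tabulate (λ _ → true)) _ x∈))) walk)
... | yes (_ , x₀∈X) = dicolourable G connected blocks parts x₀∈X p<q degree colourable
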